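{- Let $m\geq 1$ be a fixed integer. With $A_n$, $l_n$, $A$, $F(A,\cdot)$ and $F_n = F(A,l_n)$ as defined in the context (all depending on $m$), the logarithm of the growth rate of the size of the set of inflated generalised random Fibonacci words equals the topological entropy $\lim_{N\to\infty}\frac{1}{N}\log|F(A,N)|$ of the generalised random Fibonacci chain; that is, $$\lim_{n\to\infty}\frac{\log|A_n|}{l_n} = \lim_{n\to\infty}\frac{\log|F_n|}{l_n}.$$
   Context: Words are finite sequences of symbols from $\{0,1\}$. For a word $w=w_1w_2\cdots w_r$, $w[a,b]=w_aw_{a+1}\cdots w_b$ denotes a sub-word (the empty word if $b=a-1$), and for a set of words $W$, $W[a,b]=\{w[a,b]:w\in W\}$. $|\cdot|$ denotes the length of a word or the cardinality of a set. For sets of words $U,V$, the product is $UV=\{uv:u\in U,v\in V\}$ (all concatenations); $\prod_{j=0}^{m}$ denotes such a product of sets taken in order of increasing $j$ from left to right. Fix an integer $m\ge 1$. The generalised random Fibonacci substitution maps $0\mapsto 1$ and $1\mapsto 1^i01^{m-i}$ with probability $p_i$ ($0\le i\le m$), applied independently to each occurrence of $1$. The sets of inflated words are defined by $A_1=\{0\}$, $A_2=\{1\}$ and, for $n\ge 3$, $$A_n=\bigcup_{i=0}^{m}\prod_{j=0}^{m}A_{n-1-\delta_{ij}},$$ where $\delta_{ij}=1$ if $i=j$ and $0$ otherwise. All words in $A_n$ have the same length, denoted $l_n$; so $l_1=l_2=1$ and $l_n=m\,l_{n-1}+l_{n-2}$ for $n\ge3$. $A:=\lim_{n\to\infty}A_n$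 is the set of right-infinite words $x$ over $\{0,1\}$ such that for every $n\ge 3$ the prefix of $x$ of length $l_n-1$ belongs to $A_n[1,l_n-1]$ (these prefix sets are consistent: $A_n[1,l_n-1]=A_{n+k}[1,l_n-1]$ for $n\geq 3$, $k\geq 0$). A finite word $x$ is a factor of a (finite or right-infinite) word $w$ if $w=uxv$ for some (possibly empty) words $u,v$, with $u$ finite and $v$ right-infinite if $w$ is. For a set $S$ of words, $F(S,N)$ is the set of all factors of length $N$ of words in $S$. Put $F_n:=F(A,l_n)$. The topological entropy of the generalised random Fibonacci chain is $\lim_{N\to\infty}\frac1N\log|F(A,N)|$, which exists by subadditivity. -}

module Defs where

import Algebra.Properties.Group
open import Data.Bool.Base using (if_then_else_)
open import Data.Digit using (Bit; 0b; 1b)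
open import Data.Fin.Base using (Fin)
open import Data.Fin.Properties using () renaming (_≟_ to _≟ᶠ_)
open import Data.Integer.Base using (+_)
import Data.Integer.Base as ℤ
import Data.Integer.Properties as ℤₚ
open import Data.List.Base using (List; []; _∷_; _++_; length; take; drop; applyUpTo)
open import Data.List.Membership.Propositional using () renaming (_∈_ to _∈ˡ_)
open import Data.List.Relation.Unary.Unique.Propositional using (Unique)
open import Data.Nat.Base using (ℕ; zero; suc; pred; _≤_; s≤s; z≤n)
import Data.Nat.Base as ℕ
import Data.Nat.Properties as ℕₚ
open import Data.Product.Base using (∃; ∃-syntax; _×_; _,_)
open import Data.Rational.Base as ℚ using (ℚ; 0ℚ; 1ℚ; _/_; ∣_∣)
import Data.Rational.Properties as ℚₚ
import Data.Rational.Unnormalised.Base as ℚᵘ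
import Data.Rational.Unnormalised.Properties as ℚᵘₚ
open import Data.Sum.Base using ([_,_]′)
open import Data.Vec.Functional using (Vector; foldr)
open import Level using (0ℓ)
open import Relation.Binary.PropositionalEquality
  using (_≡_; _≗_; refl; sym; trans; cong; cong₂; subst; subst₂)
open import Relation.Nullary.Decidable.Core using (does)
open import Relation.Unary using (Pred; ∅; ｛_｝; ⋃; _∈_)

------------------------------------------------------------------------
-- Words

Word : Set
Word = List Bit

-- Letter number i + 1 of the infinite word x is x i.
InfiniteWord : Set
InfiniteWord = ℕ → Bit

WordSet : Set₁
WordSet = Pred Word 0ℓ

infixr 5 _·_ _⧺_

_·_ : WordSet → WordSet → WordSet
(U · V) w = ∃[ u ] ∃[ v ] u ∈ U × v ∈ V × w ≡ u ++ v

∏ : ∀ {n} → Vector WordSet n → WordSet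
∏ = foldr _·_ ｛ [] ｝

_⧺_ : Word → InfiniteWord → InfiniteWord
([]      ⧺ x) i       = x i
((c ∷ w) ⧺ x) zero    = c
((c ∷ w) ⧺ x) (suc i) = (w ⧺ x) i

-- Positions are counted from 1; only meant for 1 ≤ a.
_⟨_,_⟩ : Word → ℕ → ℕ → Word
w ⟨ a , b ⟩ = take (suc b ℕ.∸ a) (drop (a ℕ.∸ 1) w)

_⟦_,_⟧ : WordSet → ℕ → ℕ → WordSet
(W ⟦ a , b ⟧) u = ∃[ w ] w ∈ W × u ≡ w ⟨ a , b ⟩

------------------------------------------------------------------------
-- Inflated words

-- Both families are indexed from 1; the values at 0 are placeholders.

l : ℕ → ℕ → ℕ
l m 0                   = 0
l m 1                   = 1
l m 2                   = 1
l m (suc (suc (suc n))) = m ℕ.* l m (suc (suc n)) ℕ.+ l m (suc n)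

A : ℕ → ℕ → WordSet
A m 0                   = ∅
A m 1                   = ｛ 0b ∷ [] ｝
A m 2                   = ｛ 1b ∷ [] ｝
A m (suc (suc (suc n))) =
  ⋃[ i ∶ Fin (suc m) ] ∏ {suc m} (λ j → if does (i ≟ᶠ j) then A m (suc n) else A m (suc (suc n)))

A∞ : ℕ → Pred InfiniteWord 0ℓ
A∞ m x = ∀ n → 3 ≤ n → applyUpTo x (l m n ℕ.∸ 1) ∈ A m n ⟦ 1 , l m n ℕ.∸ 1 ⟧

FactorOf : InfiniteWord → WordSet
FactorOf w x = ∃[ u ] ∃[ v ] w ≗ (u ⧺ (x ⧺ v))

F : Pred InfiniteWord 0ℓ → ℕ → WordSet
F S N x = length x ≡ N × ∃[ w ] w ∈ S × x ∈ FactorOf w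

------------------------------------------------------------------------
-- Finite sets of words and their cardinality

record Finite (W : WordSet) : Set where
  field
    elements : List Word
    unique   : Unique elements
    sound    : ∀ {w} → w ∈ˡ elements → w ∈ W
    complete : ∀ {w} → w ∈ W → w ∈ˡ elements

card : ∀ {W} → Finite W → ℕ
card fin = length (Finite.elements fin)

------------------------------------------------------------------------
-- Real numbers: Bishop's regular sequences

1/suc : ℕ → ℚ
1/suc k = + 1 / suc k

-- The rational  approx k  is within 1 / (k + 1) of the real number.
record ℝ : Set where
  field
    approx  : ℕ → ℚ
    regular : ∀ j k → ∣ approx j ℚ.- approx k ∣ ℚ.≤ 1/suc j ℚ.+ 1/suc k

open ℝ public

-- ∣ x - y ∣≤ ε  is the order of the reals applied to |x - y| and the
-- rational ε, spelled out on approximations.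
∣_-_∣≤_ : ℝ → ℝ → ℚ → Set
∣ x - y ∣≤ ε = ∀ k → ∣ approx x k ℚ.- approx y k ∣ ℚ.≤ ε ℚ.+ (1/suc k ℚ.+ 1/suc k)

infix 4 _⟶_

_⟶_ : (ℕ → ℝ) → ℝ → Set
x ⟶ h = ∀ ε → 0ℚ ℚ.< ε → ∃[ n₀ ] (∀ n → n₀ ≤ n → ∣ x n - h ∣≤ ε)

module RationalBounds where

  1/suc-nonNeg : ∀ k → 0ℚ ℚ.≤ 1/suc k
  1/suc-nonNeg k = ℚₚ.nonNegative⁻¹ (1/suc k) {{ℚₚ.normalize-nonNeg 1 (suc k)}}

  toℚᵘ-/ : ∀ n d .{{_ : ℕ.NonZero d}} → ℚ.toℚᵘ (n / d) ℚᵘ.≃ (n ℚᵘ./ d)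
  toℚᵘ-/ n (suc d) = ℚₚ.toℚᵘ-fromℚᵘ (ℚᵘ.mkℚᵘ n d)

  1/suc-antimono : ∀ {j k} → j ≤ k → 1/suc k ℚ.≤ 1/suc j
  1/suc-antimono {j} {k} j≤k = ℚₚ.toℚᵘ-cancel-≤
    (ℚᵘₚ.≤-respˡ-≃ (ℚᵘₚ.≃-sym (toℚᵘ-/ (+ 1) (suc k)))
    (ℚᵘₚ.≤-respʳ-≃ (ℚᵘₚ.≃-sym (toℚᵘ-/ (+ 1) (suc j)))
    (ℚᵘ.*≤* (ℤₚ.*-monoˡ-≤-nonNeg (+ 1) (ℤ.+≤+ (s≤s j≤k))))))

  1/suc≤1 : ∀ k → 1/suc k ℚ.≤ 1ℚ
  1/suc≤1 k = 1/suc-antimono {0} {k} z≤n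

  0≤x+y : ∀ {x y} → 0ℚ ℚ.≤ x → 0ℚ ℚ.≤ y → 0ℚ ℚ.≤ x ℚ.+ y
  0≤x+y {x} {y} p q = subst (ℚ._≤ (x ℚ.+ y)) (ℚₚ.+-identityˡ 0ℚ) (ℚₚ.+-mono-≤ p q)

  ÷-regular : ∀ (x : ℝ) n j k →
              ∣ approx x j ℚ.* 1/suc n ℚ.- approx x k ℚ.* 1/suc n ∣ ℚ.≤ 1/suc j ℚ.+ 1/suc k
  ÷-regular x n j k = begin
    ∣ a ℚ.* c ℚ.- b ℚ.* c ∣           ≡⟨ cong (λ t → ∣ a ℚ.* c ℚ.+ t ∣) (ℚₚ.neg-distribˡ-* b c) ⟩
    ∣ a ℚ.* c ℚ.+ (ℚ.- b) ℚ.* c ∣     ≡⟨ cong ∣_∣ (sym (ℚₚ.*-distribʳ-+ c a (ℚ.- b))) ⟩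
    ∣ (a ℚ.- b) ℚ.* c ∣               ≡⟨ ℚₚ.∣p*q∣≡∣p∣*∣q∣ (a ℚ.- b) c ⟩
    ∣ a ℚ.- b ∣ ℚ.* ∣ c ∣             ≡⟨ cong (∣ a ℚ.- b ∣ ℚ.*_) (ℚₚ.0≤p⇒∣p∣≡p (1/suc-nonNeg n)) ⟩
    ∣ a ℚ.- b ∣ ℚ.* c                 ≤⟨ ℚₚ.*-monoˡ-≤-nonNeg ∣ a ℚ.- b ∣ {{ℚ.nonNegative (ℚₚ.0≤∣p∣ (a ℚ.- b))}} (1/suc≤1 n) ⟩
    ∣ a ℚ.- b ∣ ℚ.* 1ℚ                ≡⟨ ℚₚ.*-identityʳ _ ⟩
    ∣ a ℚ.- b ∣                       ≤⟨ regular x j k ⟩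
    1/suc j ℚ.+ 1/suc k               ∎
    where
    open ℚₚ.≤-Reasoning
    a = approx x j
    b = approx x k
    c = 1/suc n

open RationalBounds

-- Total division by a natural number, with x ÷ 0 = 0.
infixl 7 _÷_

_÷_ : ℝ → ℕ → ℝ
x ÷ zero = record
  { approx  = λ _ → 0ℚ
  ; regular = λ j k → 0≤x+y (1/suc-nonNeg j) (1/suc-nonNeg k)
  }
x ÷ suc n = record
  { approx  = λ k → approx x k ℚ.* 1/suc n
  ; regular = ÷-regular x n
  }

------------------------------------------------------------------------
-- The natural logarithm of a natural number

-- 1/(k+2) + 1/(k+3) + … + 1/(k+1+n): the right Riemann sum of dt/t over
-- n intervals of length 1/(k+1), starting at t = 1.
riemann : ℕ → ℕ → ℚ
riemann k zero    = 0ℚ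
riemann k (suc n) = riemann k n ℚ.+ 1/suc (suc k ℕ.+ n)

module RiemannSums where

  riemann-+ : ∀ p a b → riemann p (a ℕ.+ b) ≡ riemann p a ℚ.+ riemann (p ℕ.+ a) b
  riemann-+ p a zero = trans (cong (riemann p) (ℕₚ.+-identityʳ a)) (sym (ℚₚ.+-identityʳ _))
  riemann-+ p a (suc b) = trans (cong (riemann p) (ℕₚ.+-suc a b))
    (trans (cong₂ ℚ._+_ (riemann-+ p a b) (cong (λ t → 1/suc (suc t)) (sym (ℕₚ.+-assoc p a b))))
           (ℚₚ.+-assoc (riemann p a) _ _))

  _×/_ : ℕ → ℚ → ℚ
  zero  ×/ c = 0ℚ
  suc n ×/ c = n ×/ c ℚ.+ c

  ×/-≡ : ∀ n c → n ×/ c ≡ (+ n / 1) ℚ.* c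
  ×/-≡ zero    c = sym (ℚₚ.*-zeroˡ c)
  ×/-≡ (suc n) c = trans (cong₂ ℚ._+_ (×/-≡ n c) (sym (ℚₚ.*-identityˡ c)))
    (trans (sym (ℚₚ.*-distribʳ-+ c (+ n / 1) 1ℚ)) (cong (ℚ._* c) eq))
    where
    eq : (+ n / 1) ℚ.+ 1ℚ ≡ + suc n / 1
    eq = ℚₚ.toℚᵘ-injective (ℚᵘₚ.≃-trans (ℚₚ.toℚᵘ-homo-+ (+ n / 1) 1ℚ)
      (ℚᵘₚ.≃-trans (ℚᵘₚ.+-congˡ ℚᵘ.1ℚᵘ (toℚᵘ-/ (+ n) 1))
      (ℚᵘₚ.≃-trans
        (ℚᵘ.*≡* (cong (ℤ._* + 1) (trans (cong (ℤ._+ + 1) (ℤₚ.*-identityʳ (+ n))) (cong +_ (ℕₚ.+-comm n 1)))))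
        (ℚᵘₚ.≃-sym (toℚᵘ-/ (+ suc n) 1)))))

  ×/-1/suc : ∀ j q r → suc q ≡ suc j ℕ.* suc r → suc j ×/ 1/suc q ≡ 1/suc r
  ×/-1/suc j q r e = trans (×/-≡ (suc j) (1/suc q))
    (ℚₚ.toℚᵘ-injective (ℚᵘₚ.≃-trans (ℚₚ.toℚᵘ-homo-* (+ suc j / 1) (1/suc q))
    (ℚᵘₚ.≃-trans (ℚᵘₚ.*-cong (toℚᵘ-/ (+ suc j) 1) (toℚᵘ-/ (+ 1) (suc q)))
    (ℚᵘₚ.≃-trans (ℚᵘ.*≡* eq) (ℚᵘₚ.≃-sym (toℚᵘ-/ (+ 1) (suc r)))))))
    where
    eq : (+ suc j ℤ.* + 1) ℤ.* + suc r ≡ + 1 ℤ.* + (1 ℕ.* suc q)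
    eq = trans (cong (ℤ._* + suc r) (ℤₚ.*-identityʳ (+ suc j)))
      (trans (sym (ℤₚ.pos-* (suc j) (suc r)))
      (sym (trans (ℤₚ.*-identityˡ _) (cong +_ (trans (ℕₚ.*-identityˡ (suc q)) e)))))

  riemann-upper : ∀ q n → riemann q n ℚ.≤ n ×/ 1/suc q
  riemann-upper q zero    = ℚₚ.≤-refl
  riemann-upper q (suc n) = ℚₚ.+-mono-≤ (riemann-upper q n)
    (1/suc-antimono (ℕₚ.m≤n⇒m≤1+n (ℕₚ.m≤m+n q n)))

  riemann-lower : ∀ q N n → n ≤ N → n ×/ 1/suc (q ℕ.+ N) ℚ.≤ riemann q n
  riemann-lower q N zero    _   = ℚₚ.≤-refl
  riemann-lower q N (suc n) n<N = ℚₚ.+-mono-≤ (riemann-lower q N n (ℕₚ.<⇒≤ n<N))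
    (1/suc-antimono (subst (_≤ (q ℕ.+ N)) (ℕₚ.+-suc q n) (ℕₚ.+-monoʳ-≤ q n<N)))

  -- Subdividing each of n intervals of length 1/(k+1) into j + 1 equal parts.
  module Refine (k j p : ℕ) (p≡ : suc p ≡ suc j ℕ.* suc k) where

    at : ∀ n → suc (p ℕ.+ n ℕ.* suc j) ≡ suc j ℕ.* suc (k ℕ.+ n)
    at n = trans (cong₂ ℕ._+_ p≡ (ℕₚ.*-comm n (suc j))) (sym (ℕₚ.*-distribˡ-+ (suc j) (suc k) n))

    step : ∀ n → riemann p (suc n ℕ.* suc j)
               ≡ riemann p (n ℕ.* suc j) ℚ.+ riemann (p ℕ.+ n ℕ.* suc j) (suc j)
    step n = trans (cong (riemann p) (ℕₚ.+-comm (suc j) (n ℕ.* suc j)))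
                   (riemann-+ p (n ℕ.* suc j) (suc j))

    block-upper : ∀ n → riemann (p ℕ.+ n ℕ.* suc j) (suc j) ℚ.≤ 1/suc (k ℕ.+ n)
    block-upper n = subst (riemann q (suc j) ℚ.≤_) (×/-1/suc j q (k ℕ.+ n) (at n))
                          (riemann-upper q (suc j))
      where q = p ℕ.+ n ℕ.* suc j

    block-lower : ∀ n → 1/suc (suc k ℕ.+ n) ℚ.≤ riemann (p ℕ.+ n ℕ.* suc j) (suc j)
    block-lower n = subst (ℚ._≤ riemann q (suc j))
      (×/-1/suc j (q ℕ.+ suc j) (suc k ℕ.+ n) eq)
      (riemann-lower q (suc j) (suc j) ℕₚ.≤-refl)
      where
      q = p ℕ.+ n ℕ.* suc j
      eq : suc (q ℕ.+ suc j) ≡ suc j ℕ.* suc (suc k ℕ.+ n)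
      eq = trans (cong suc (trans (ℕₚ.+-assoc p _ _) (cong (p ℕ.+_) (ℕₚ.+-comm (n ℕ.* suc j) (suc j)))))
        (trans (at (suc n)) (cong (λ t → suc j ℕ.* suc t) (ℕₚ.+-suc k n)))

    lower : ∀ n → riemann k n ℚ.≤ riemann p (n ℕ.* suc j)
    lower zero    = ℚₚ.≤-refl
    lower (suc n) = subst (riemann k (suc n) ℚ.≤_) (sym (step n))
                          (ℚₚ.+-mono-≤ (lower n) (block-lower n))

    upper′ : ∀ n → riemann p (n ℕ.* suc j) ℚ.+ 1/suc (k ℕ.+ n) ℚ.≤ riemann k n ℚ.+ 1/suc k
    upper′ zero    = ℚₚ.≤-reflexive (cong (λ t → 0ℚ ℚ.+ 1/suc t) (ℕₚ.+-identityʳ k))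
    upper′ (suc n) = begin
      riemann p (suc n ℕ.* suc j) ℚ.+ 1/suc (k ℕ.+ suc n)
        ≡⟨ cong₂ (λ s t → s ℚ.+ 1/suc t) (step n) (ℕₚ.+-suc k n) ⟩
      (u ℚ.+ riemann (p ℕ.+ n ℕ.* suc j) (suc j)) ℚ.+ c
        ≤⟨ ℚₚ.+-monoˡ-≤ c (ℚₚ.+-monoʳ-≤ u (block-upper n)) ⟩
      (u ℚ.+ 1/suc (k ℕ.+ n)) ℚ.+ c
        ≤⟨ ℚₚ.+-monoˡ-≤ c (upper′ n) ⟩
      (riemann k n ℚ.+ 1/suc k) ℚ.+ c
        ≡⟨ trans (ℚₚ.+-assoc v _ _) (trans (cong (v ℚ.+_) (ℚₚ.+-comm _ c)) (sym (ℚₚ.+-assoc v _ _))) ⟩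
      riemann k (suc n) ℚ.+ 1/suc k ∎
      where
      open ℚₚ.≤-Reasoning
      c = 1/suc (suc k ℕ.+ n)
      u = riemann p (n ℕ.* suc j)
      v = riemann k n

    upper : ∀ n → riemann p (n ℕ.* suc j) ℚ.≤ riemann k n ℚ.+ 1/suc k
    upper n = ℚₚ.≤-trans
      (subst (ℚ._≤ (riemann p (n ℕ.* suc j) ℚ.+ 1/suc (k ℕ.+ n))) (ℚₚ.+-identityʳ _)
        (ℚₚ.+-monoʳ-≤ (riemann p (n ℕ.* suc j)) (1/suc-nonNeg (k ℕ.+ n))))
      (upper′ n)

  module ℚ-group = Algebra.Properties.Group ℚₚ.+-0-group

  x-y≤e : ∀ {x z y e} → x ℚ.≤ z → z ℚ.≤ y ℚ.+ e → x ℚ.- y ℚ.≤ e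
  x-y≤e {x} {z} {y} {e} x≤z z≤y+e = begin
    x ℚ.- y              ≤⟨ ℚₚ.+-monoˡ-≤ (ℚ.- y) (ℚₚ.≤-trans x≤z z≤y+e) ⟩
    (y ℚ.+ e) ℚ.- y      ≡⟨ cong (ℚ._- y) (ℚₚ.+-comm y e) ⟩
    (e ℚ.+ y) ℚ.- y      ≡⟨ ℚₚ.+-assoc e y (ℚ.- y) ⟩
    e ℚ.+ (y ℚ.- y)      ≡⟨ cong (e ℚ.+_) (ℚₚ.+-inverseʳ y) ⟩
    e ℚ.+ 0ℚ             ≡⟨ ℚₚ.+-identityʳ e ⟩
    e                    ∎
    where open ℚₚ.≤-Reasoning

  ∣x-y∣≤ : ∀ {x y e} → x ℚ.- y ℚ.≤ e → y ℚ.- x ℚ.≤ e → ∣ x ℚ.- y ∣ ℚ.≤ e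
  ∣x-y∣≤ {x} {y} {e} p q = [ (λ eq → subst (ℚ._≤ e) (sym eq) p)
    , (λ eq → subst (ℚ._≤ e) (sym (trans eq (neg-swap x y))) q)
    ]′ (ℚₚ.∣p∣≡p∨∣p∣≡-p (x ℚ.- y))
    where
    neg-swap : ∀ x y → ℚ.- (x ℚ.- y) ≡ y ℚ.- x
    neg-swap x y = trans (ℚₚ.neg-distrib-+ x (ℚ.- y))
      (trans (cong (ℚ.- x ℚ.+_) (ℚ-group.⁻¹-involutive y)) (ℚₚ.+-comm (ℚ.- x) y))

  ln-regular : ∀ a j k → ∣ riemann j (a ℕ.* suc j) ℚ.- riemann k (a ℕ.* suc k) ∣
                         ℚ.≤ 1/suc j ℚ.+ 1/suc k
  ln-regular a j k = ∣x-y∣≤ {x} {y} {1/suc j ℚ.+ 1/suc k}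
    (ℚₚ.≤-trans
      (x-y≤e {x} {z} {y} (J.lower n) (subst (λ t → t ℚ.≤ y ℚ.+ 1/suc k) swap (K.upper o)))
      (subst (ℚ._≤ (1/suc j ℚ.+ 1/suc k)) (ℚₚ.+-identityˡ (1/suc k))
        (ℚₚ.+-monoˡ-≤ (1/suc k) (1/suc-nonNeg j))))
    (ℚₚ.≤-trans
      (x-y≤e {y} {z} {x} (subst (y ℚ.≤_) swap (K.lower o)) (J.upper n))
      (subst (ℚ._≤ (1/suc j ℚ.+ 1/suc k)) (ℚₚ.+-identityʳ (1/suc j))
        (ℚₚ.+-monoʳ-≤ (1/suc j) (1/suc-nonNeg k))))
    where
    n = a ℕ.* suc j
    o = a ℕ.* suc k
    p = k ℕ.+ j ℕ.* suc k
    q = j ℕ.+ k ℕ.* suc j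
    x = riemann j n
    y = riemann k o
    z = riemann q (n ℕ.* suc k)
    q≡ : suc q ≡ suc k ℕ.* suc j
    q≡ = refl
    p≡ : suc p ≡ suc j ℕ.* suc k
    p≡ = refl
    module J = Refine j k q q≡
    module K = Refine k j p p≡
    swap : riemann p (o ℕ.* suc j) ≡ z
    swap = cong₂ riemann (ℕₚ.suc-injective (ℕₚ.*-comm (suc j) (suc k)))
      (trans (ℕₚ.*-assoc a (suc k) (suc j))
      (trans (cong (a ℕ.*_) (ℕₚ.*-comm (suc k) (suc j))) (sym (ℕₚ.*-assoc a (suc j) (suc k)))))

open RiemannSums

-- ln a = ∫₁ᵃ dt/t for a ≥ 1, and ln 0 = 0.  The right Riemann sum of mesh
-- 1/(k+1) is below the integral by at most 1/(k+1).
ln : ℕ → ℝ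
ln a = record
  { approx  = λ k → riemann k (pred a ℕ.* suc k)
  ; regular = ln-regular (pred a)
  }

{-# OPTIONS --safe #-}
module Submission where

-- Write aₙ = |Aₙ| and b = m + 1. As all words of Aₙ have the same length, aₙ₊₁ᵐ aₙ ≤ aₙ₊₂ ≤ b aₙ₊₁ᵐ aₙ, the same
-- recursion as that of lₙ up to a constant factor; hence log aₙ / lₙ and log aₙ₊₁ / lₙ₊₁ differ by O(1 / lₙ).
-- Every word of A is a concatenation of blocks from Aₖ ∪ Aₖ₊₁. Counting the ways of filling N letters with such
-- blocks gives log |F(A,N)| ≤ (log aₖ / lₖ + O(1 / lₖ)) N + Oₖ(1). For the converse choose n with N ≤ lₙ ≤ b N and
-- cut the words of Aₙ at position N: aₙ ≤ |F(A,N)| |F(A,lₙ−N)|, where the last factor is bounded above already.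
-- So log |F(A,N)| / N is within O(1 / lₖ) of log aₖ / lₖ once N is large in terms of k. This makes both sequences
-- Cauchy, with an explicit modulus and the same limit.

open import Defs
open import Data.Bool.Base using (true; false; if_then_else_)
open import Data.Digit using (0b; 1b)
open import Data.Empty using (⊥-elim)
open import Data.Fin.Base using (Fin; zero; suc; fromℕ)
open import Data.Fin.Properties using () renaming (_≟_ to _≟ᶠ_)
import Data.Integer.Base as ℤ
import Data.Integer.Properties as ℤₚ
open import Data.List.Base
  using (List; []; _∷_; _++_; length; map; take; drop; cartesianProductWith; concatMap; filter; applyUpTo; upTo; deduplicate)
open import Data.List.Properties
  using (∷-injective; ++-assoc; ++-identityʳ; ++-cancelˡ; ++-conicalˡ; ++-conicalʳ; ≡-dec; length-++; length-++-sucʳ;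
         length-++-≤ˡ; length-++-≤ʳ; length-map; length-take; length-drop; take-all; take-take; take++drop≡id)
open import Data.List.Membership.Propositional using (lose; find) renaming (_∈_ to _∈ˡ_)
open import Data.List.Membership.Propositional.Properties
  using (∈-∃++; ∈-++⁺ˡ; ∈-++⁺ʳ; ∈-++⁻; ∈-map⁺; ∈-map⁻; ∈-deduplicate⁺; ∈-deduplicate⁻; ∈-concatMap⁺; ∈-concatMap⁻;
         ∈-filter⁺; ∈-filter⁻; ∈-upTo⁺; ∈-cartesianProductWith⁺; ∈-cartesianProductWith⁻)
open import Data.List.Relation.Unary.All as All using ([])
open import Data.List.Relation.Unary.AllPairs using ([]; _∷_)
open import Data.List.Relation.Unary.Any using (here; there)
open import Data.List.Relation.Unary.Unique.DecPropositional.Properties using (deduplicate-!)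
open import Data.List.Relation.Unary.Unique.Propositional using (Unique)
import Data.List.Relation.Unary.Unique.Propositional.Properties as Unique
open import Data.Nat.Base
open import Data.Nat.Induction using (<-rec)
open import Data.Nat.Properties
open import Data.Nat.Solver using () renaming (module +-*-Solver to ℕ-Solver)
open import Data.Product.Base using (∃₂; ∃-syntax; Σ-syntax; _×_; _,_; proj₁; proj₂)
open import Data.Rational.Base as ℚ using (ℚ; 0ℚ; 1ℚ; ∣_∣; mkℚ)
import Data.Rational.Properties as ℚₚ
open import Data.Rational.Solver using () renaming (module +-*-Solver to ℚ-Solver)
import Data.Rational.Unnormalised.Base as ℚᵘ
import Data.Rational.Unnormalised.Properties as ℚᵘₚ
open import Data.Sum.Base using (_⊎_; inj₁; inj₂; [_,_]′)
open import Data.Vec.Functional using (Vector)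
open import Function.Base using (_∘_; const)
open import Relation.Binary.Definitions using (DecidableEquality)
open import Relation.Binary.PropositionalEquality
open import Relation.Nullary.Decidable.Core using (does)
open import Relation.Unary using (_∈_; _⊆_; _∪_; ｛_｝; ∅; ⋃)

-- Counting words

-- The limit is sought among Bishop's reals, where boundedness and subadditivity alone do not yield
-- it: an explicit rate is wanted, and for all N, not only for N = lₙ. The inclusion of Aₙ in F(A,
-- lₙ) bounds |F(A,N)| from below only at those lengths; cutting a word of Aₙ in two reaches every
-- N. Roots and logarithms are postponed. The growth estimates are inequalities between powers of
-- natural numbers, such as y ^ L ≤ x ^ N * (Q ^ N * K) with L = lₖ, where Q is the same for all k
-- while K may depend on k. After logarithms and division by N L, the factor Q ^ N leaves O(1 / L)
-- and K fades as N grows. The approximate logarithm at a fixed precision is additive only up to a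
-- bounded error, which is absorbed in the same way, uniformly in the precision.

infix 4 _≟ʷ_

_≟ʷ_ : DecidableEquality Word
_≟ʷ_ = ≡-dec _≟ᶠ_

Unique⇒length≤ : ∀ {xs ys : List Word} → Unique xs → (∀ {w} → w ∈ˡ xs → w ∈ˡ ys) → length xs ≤ length ys
Unique⇒length≤ [] _ = z≤n
Unique⇒length≤ {x ∷ xs} (x∉xs ∷ uxs) xs⊆ys with ∈-∃++ (xs⊆ys (here refl))
... | ys₁ , ys₂ , refl = subst (suc (length xs) ≤_) (sym (length-++-sucʳ ys₁ x ys₂))
    (s≤s (Unique⇒length≤ uxs avoid))
  where
  avoid : ∀ {w} → w ∈ˡ xs → w ∈ˡ ys₁ ++ ys₂
  avoid w∈ with ∈-++⁻ ys₁ (xs⊆ys (there w∈))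
  ... | inj₁ p           = ∈-++⁺ˡ p
  ... | inj₂ (here refl) = ⊥-elim (All.lookup x∉xs w∈ refl)
  ... | inj₂ (there p)   = ∈-++⁺ʳ ys₁ p

++-injective-length : ∀ (u : Word) {u′ v v′} → length u ≡ length u′ → u ++ v ≡ u′ ++ v′ → u ≡ u′ × v ≡ v′
++-injective-length []      {[]}     _ e    = refl , e
++-injective-length (c ∷ u) {_ ∷ u′} p e with ∷-injective e
... | refl , e′ with ++-injective-length u {u′} (suc-injective p) e′
... | refl , q = refl , q

++-split : ∀ (u u′ : Word) {v v′} → length u ≤ length u′ → u ++ v ≡ u′ ++ v′ → ∃[ t ] u′ ≡ u ++ t × v ≡ t ++ v′
++-split []      u′       _       e    = u′ , refl , e
++-split (c ∷ u) (_ ∷ u′) (s≤s p) e with ∷-injective e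
... | refl , e′ with ++-split u u′ p e′
... | t , refl , q = t , refl , q

length-product : ∀ (vs ws : List Word) → length (cartesianProductWith _++_ vs ws) ≡ length vs * length ws
length-product []       ws = refl
length-product (v ∷ vs) ws = trans (length-++ (map (v ++_) ws))
  (cong₂ _+_ (length-map (v ++_) ws) (length-product vs ws))

-- Repetitions and words outside W are allowed in the list, so upper bounds can be given for sets
-- that are not enumerated exactly, such as `Prefix` and `Short`.
record Cover (W : WordSet) (c : ℕ) : Set where
  constructor cover
  field
    words  : List Word
    covers : ∀ {w} → w ∈ W → w ∈ˡ words
    size   : length words ≤ c

record Packing (W : WordSet) (c : ℕ) : Set where
  constructor packing
  field
    words  : List Word
    unique : Unique words
    sound  : ∀ {w} → w ∈ˡ words → w ∈ W
    size   : c ≤ length words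

Finite⇒Cover : ∀ {W} (fin : Finite W) → Cover W (card fin)
Finite⇒Cover fin = cover elements complete ≤-refl
  where open Finite fin

Finite⇒Packing : ∀ {W} (fin : Finite W) → Packing W (card fin)
Finite⇒Packing fin = packing elements unique sound ≤-refl
  where open Finite fin

card≤Cover : ∀ {W c} (fin : Finite W) → Cover W c → card fin ≤ c
card≤Cover fin (cover ws cov sz) = ≤-trans (Unique⇒length≤ unique (cov ∘ sound)) sz
  where open Finite fin

Packing≤card : ∀ {W c} (fin : Finite W) → Packing W c → c ≤ card fin
Packing≤card fin (packing ws un so sz) = ≤-trans sz (Unique⇒length≤ un (complete ∘ so))
  where open Finite fin

enumerated⇒Finite : ∀ {W : WordSet} ws → (∀ {w} → w ∈ˡ ws → w ∈ W) → (∀ {w} → w ∈ W → w ∈ˡ ws) → Finite W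
enumerated⇒Finite ws so co = record
  { elements = deduplicate _≟ʷ_ ws
  ; unique   = deduplicate-! _≟ʷ_ ws
  ; sound    = so ∘ ∈-deduplicate⁻ _≟ʷ_ ws
  ; complete = ∈-deduplicate⁺ _≟ʷ_ ∘ co
  }

Cover-mono : ∀ {V W c d} → V ⊆ W → c ≤ d → Cover W c → Cover V d
Cover-mono V⊆W c≤d (cover ws cov sz) = cover ws (cov ∘ V⊆W) (≤-trans sz c≤d)

Packing-mono : ∀ {V W c} → V ⊆ W → Packing V c → Packing W c
Packing-mono V⊆W (packing ws un so sz) = packing ws un (V⊆W ∘ so) sz

Cover-∪ : ∀ {V W c d} → Cover V c → Cover W d → Cover (V ∪ W) (c + d)
Cover-∪ (cover vs covᵛ szᵛ) (cover ws covʷ szʷ) = cover (vs ++ ws)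
  [ ∈-++⁺ˡ ∘ covᵛ , ∈-++⁺ʳ vs ∘ covʷ ]′
  (≤-trans (≤-reflexive (length-++ vs)) (+-mono-≤ szᵛ szʷ))

Cover-· : ∀ {V W c d} → Cover V c → Cover W d → Cover (V · W) (c * d)
Cover-· (cover vs covᵛ szᵛ) (cover ws covʷ szʷ) = cover (cartesianProductWith _++_ vs ws)
  (λ { (v , w , v∈ , w∈ , refl) → ∈-cartesianProductWith⁺ _++_ (covᵛ v∈) (covʷ w∈) })
  (≤-trans (≤-reflexive (length-product vs ws)) (*-mono-≤ szᵛ szʷ))

Cover-singleton : ∀ w → Cover ｛ w ｝ 1
Cover-singleton w = cover (w ∷ []) (λ { refl → here refl }) ≤-refl

Packing-singleton : ∀ w → Packing ｛ w ｝ 1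
Packing-singleton w = packing (w ∷ []) ([] ∷ []) (λ { (here refl) → refl }) ≤-refl

OfLength : ℕ → WordSet → Set
OfLength n W = ∀ {w} → w ∈ W → length w ≡ n

-- Concatenation is injective on pairs whose first components have equal length, so distinct pairs
-- give distinct words.
Packing-· : ∀ {V W c d n} → OfLength n V → Packing V c → Packing W d → Packing (V · W) (c * d)
Packing-· {V} {W} ofLength (packing vs unᵛ soᵛ szᵛ) (packing ws unʷ soʷ szʷ) =
  packing (cartesianProductWith _++_ vs ws) (product-unique vs unᵛ soᵛ) product-sound
    (≤-trans (*-mono-≤ szᵛ szʷ) (≤-reflexive (sym (length-product vs ws))))
  where
  product-sound : ∀ {w} → w ∈ˡ cartesianProductWith _++_ vs ws → w ∈ V · W
  product-sound w∈ with ∈-cartesianProductWith⁻ _++_ vs ws w∈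
  ... | v , w , v∈ , w∈′ , e = v , w , soᵛ v∈ , soʷ w∈′ , e
  product-unique : ∀ us → Unique us → (∀ {w} → w ∈ˡ us → w ∈ V) → Unique (cartesianProductWith _++_ us ws)
  product-unique []       _            _   = []
  product-unique (u ∷ us) (u∉us ∷ un) so = Unique.++⁺
    (Unique.map⁺ (++-cancelˡ u _ _) unʷ)
    (product-unique us un (so ∘ there))
    λ { (p , q) → disjoint p q }
    where
    disjoint : ∀ {w} → w ∈ˡ map (u ++_) ws → w ∈ˡ cartesianProductWith _++_ us ws → _
    disjoint p q with ∈-map⁻ (u ++_) p | ∈-cartesianProductWith⁻ _++_ us ws q
    ... | t , _ , refl | u′ , t′ , u′∈ , _ , e = All.lookup u∉us u′∈
      (proj₁ (++-injective-length u (trans (ofLength (so (here refl))) (sym (ofLength (so (there u′∈))))) e))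

AllWords : ℕ → WordSet
AllWords n w = length w ≡ n

AllWords-Cover : ∀ n → Cover (AllWords n) (2 ^ n)
AllWords-Cover zero    = Cover-mono (λ { {[]} _ → refl }) ≤-refl (Cover-singleton [])
AllWords-Cover (suc n) = Cover-mono split ≤-refl
  (Cover-· {c = 2} (cover ((0b ∷ []) ∷ (1b ∷ []) ∷ []) letters ≤-refl) (AllWords-Cover n))
  where
  letters : ∀ {w} → w ∈ AllWords 1 → w ∈ˡ (0b ∷ []) ∷ (1b ∷ []) ∷ []
  letters {zero ∷ []}     _ = here refl
  letters {suc zero ∷ []} _ = there (here refl)
  split : AllWords (suc n) ⊆ AllWords 1 · AllWords n
  split {c ∷ w} p = c ∷ [] , w , refl , suc-injective p , refl

infixr 8 _^·_

_^·_ : WordSet → ℕ → WordSet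
W ^· zero  = ｛ [] ｝
W ^· suc n = W · W ^· n

-- With U = Aₙ₋₁ and V = Aₙ₋₂, the product of these blocks is the i-th set in the union that defines Aₙ.
Blocks : ∀ {n} → WordSet → WordSet → Fin n → Vector WordSet n
Blocks U V i j = if does (i ≟ᶠ j) then V else U

∏-const⇒^· : ∀ {U} n → ∏ {n} (λ _ → U) ⊆ U ^· n
∏-const⇒^· zero    p = p
∏-const⇒^· (suc n) (u , v , u∈ , v∈ , e) = u , v , u∈ , ∏-const⇒^· n v∈ , e

^·⇒∏-const : ∀ {U} n → U ^· n ⊆ ∏ {n} (λ _ → U)
^·⇒∏-const zero    p = p
^·⇒∏-const (suc n) (u , v , u∈ , v∈ , e) = u , v , u∈ , ^·⇒∏-const n v∈ , e

Cover-^· : ∀ {U c} n → Cover U c → Cover (U ^· n) (c ^ n)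
Cover-^· zero    _ = Cover-singleton []
Cover-^· (suc n) p = Cover-· p (Cover-^· n p)

Packing-^· : ∀ {U c k} n → OfLength k U → Packing U c → Packing (U ^· n) (c ^ n)
Packing-^· zero    _ _ = Packing-singleton []
Packing-^· (suc n) q p = Packing-· q p (Packing-^· n q p)

OfLength-· : ∀ {U V j k} → OfLength j U → OfLength k V → OfLength (j + k) (U · V)
OfLength-· p q (u , v , u∈ , v∈ , refl) = trans (length-++ u) (cong₂ _+_ (p u∈) (q v∈))

OfLength-^· : ∀ {U k} n → OfLength k U → OfLength (n * k) (U ^· n)
OfLength-^· zero    _ refl = refl
OfLength-^· (suc n) p = OfLength-· p (OfLength-^· n p)

-- Induction on the position i: `does (suc i ≟ᶠ suc j)` reduces to `does (i ≟ᶠ j)`, so the tail of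
-- the product is again a product of `Blocks`; at `zero` it is a constant product.
OfLength-Blocks : ∀ {U V j k n} (i : Fin (suc n)) → OfLength j U → OfLength k V →
                  OfLength (n * j + k) (∏ (Blocks U V i))
OfLength-Blocks {j = j} {k} {n} zero p q w∈ =
  trans (OfLength-· q (λ w∈ → OfLength-^· n p (∏-const⇒^· n w∈)) w∈) (+-comm k (n * j))
OfLength-Blocks {j = j} {k} {suc n} (suc i) p q w∈ =
  trans (OfLength-· p (OfLength-Blocks i p q) w∈) (sym (+-assoc j (n * j) k))

Cover-Blocks : ∀ {U V c d n} (i : Fin (suc n)) → Cover U c → Cover V d → Cover (∏ (Blocks U V i)) (c ^ n * d)
Cover-Blocks {c = c} {d} {n} zero p q =
  Cover-mono (λ w∈ → w∈) (≤-reflexive (*-comm d (c ^ n)))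
    (Cover-· q (Cover-mono (∏-const⇒^· n) ≤-refl (Cover-^· n p)))
Cover-Blocks {c = c} {d} {suc n} (suc i) p q =
  Cover-mono (λ w∈ → w∈) (≤-reflexive (sym (*-assoc c (c ^ n) d))) (Cover-· p (Cover-Blocks i p q))

Cover-⋃ : ∀ n {V : Fin n → WordSet} {c} → (∀ i → Cover (V i) c) → Cover (⋃ (Fin n) V) (n * c)
Cover-⋃ zero    _ = cover [] (λ ()) z≤n
Cover-⋃ (suc n) p = Cover-mono (λ { (zero , w∈) → inj₁ w∈ ; (suc i , w∈) → inj₂ (i , w∈) }) ≤-refl
  (Cover-∪ (p zero) (Cover-⋃ n (p ∘ suc)))

Finite-resp : ∀ {V W} → V ⊆ W → W ⊆ V → Finite V → Finite W
Finite-resp p q fin = record { elements = elements ; unique = unique ; sound = p ∘ sound ; complete = complete ∘ q }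
  where open Finite fin

Finite-· : ∀ {V W} → Finite V → Finite W → Finite (V · W)
Finite-· {V} {W} finV finW = enumerated⇒Finite (cartesianProductWith _++_ V.elements W.elements) so
  λ { (v , w , v∈ , w∈ , refl) → ∈-cartesianProductWith⁺ _++_ (V.complete v∈) (W.complete w∈) }
  where
  module V = Finite finV
  module W = Finite finW
  so : ∀ {w} → w ∈ˡ cartesianProductWith _++_ V.elements W.elements → w ∈ V · W
  so w∈ with ∈-cartesianProductWith⁻ _++_ V.elements W.elements w∈
  ... | v , w , v∈ , w∈′ , e = v , w , V.sound v∈ , W.sound w∈′ , e

Finite-∪ : ∀ {V W} → Finite V → Finite W → Finite (V ∪ W)
Finite-∪ finV finW = enumerated⇒Finite (V.elements ++ W.elements)
  (λ w∈ → [ inj₁ ∘ V.sound , inj₂ ∘ W.sound ]′ (∈-++⁻ V.elements w∈))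
  [ ∈-++⁺ˡ ∘ V.complete , ∈-++⁺ʳ V.elements ∘ W.complete ]′
  where
  module V = Finite finV
  module W = Finite finW

Finite-∅ : Finite ∅
Finite-∅ = enumerated⇒Finite [] (λ ()) λ ()

Finite-singleton : ∀ w → Finite ｛ w ｝
Finite-singleton w = enumerated⇒Finite (w ∷ []) (λ { (here refl) → refl }) λ { refl → here refl }

Finite-∏ : ∀ n {V : Vector WordSet n} → (∀ i → Finite (V i)) → Finite (∏ V)
Finite-∏ zero    _ = Finite-singleton []
Finite-∏ (suc n) p = Finite-· (p zero) (Finite-∏ n (p ∘ suc))

Finite-⋃ : ∀ n {V : Fin n → WordSet} → (∀ i → Finite (V i)) → Finite (⋃ (Fin n) V)
Finite-⋃ zero    _ = Finite-resp (λ ()) (λ ()) Finite-∅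
Finite-⋃ (suc n) p = Finite-resp
  (λ { (inj₁ w∈) → zero , w∈ ; (inj₂ (i , w∈)) → suc i , w∈ })
  (λ { (zero , w∈) → inj₁ w∈ ; (suc i , w∈) → inj₂ (i , w∈) })
  (Finite-∪ (p zero) (Finite-⋃ n (p ∘ suc)))

-- Inflated words and factors

infix 4 _⊑_

_⊑_ : Word → Word → Set
x ⊑ w = ∃₂ λ p s → w ≡ p ++ (x ++ s)

⊑-trans : ∀ {x y z} → x ⊑ y → y ⊑ z → x ⊑ z
⊑-trans {x} (p , s , refl) (p′ , s′ , refl) = p′ ++ p , s ++ s′ ,
  trans (cong (p′ ++_) (trans (++-assoc p (x ++ s) s′) (cong (p ++_) (++-assoc x s s′))))
        (sym (++-assoc p′ p (x ++ (s ++ s′))))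

⊑-++ˡ : ∀ p {w} → w ⊑ p ++ w
⊑-++ˡ p {w} = p , [] , cong (p ++_) (sym (++-identityʳ w))

⊑-++ʳ : ∀ {w} s → w ⊑ w ++ s
⊑-++ʳ s = [] , s , refl

^·-snoc : ∀ {W} n → W ^· n · W ⊆ W ^· suc n
^·-snoc zero    (_ , w , refl , w∈ , refl) = w , [] , w∈ , refl , sym (++-identityʳ w)
^·-snoc (suc n) (_ , w , (v , vs , v∈ , vs∈ , refl) , w∈ , refl) =
  v , vs ++ w , v∈ , ^·-snoc n (vs , w , vs∈ , w∈ , refl) , ++-assoc v vs w

Blocks-last : ∀ {U V} n → U ^· n · V ⊆ ∏ (Blocks U V (fromℕ n))
Blocks-last zero    (_ , v , refl , v∈ , refl) = v , [] , v∈ , refl , sym (++-identityʳ v)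
Blocks-last (suc n) (_ , v , (u , us , u∈ , us∈ , refl) , v∈ , refl) =
  u , us ++ v , u∈ , Blocks-last n (us , v , us∈ , v∈ , refl) , ++-assoc u us v

^·-inhabited : ∀ {W w} → w ∈ W → ∀ n → ∃[ v ] v ∈ W ^· n
^·-inhabited w∈ zero    = [] , refl
^·-inhabited w∈ (suc n) = _ , _ , _ , w∈ , proj₂ (^·-inhabited w∈ n) , refl

Finite-Blocks : ∀ {U V n} → Finite U → Finite V → ∀ (i j : Fin n) → Finite (Blocks U V i j)
Finite-Blocks finU finV i j with does (i ≟ᶠ j)
... | true  = finV
... | false = finU

take-++ : ∀ k (u : Word) {v} → k ≤ length u → take k (u ++ v) ≡ take k u
take-++ zero    u       _       = refl
take-++ (suc k) (c ∷ u) (s≤s p) = cong (c ∷_) (take-++ k u p)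

module _ (m : ℕ) where

  A-ofLength : ∀ n → OfLength (l m n) (A m n)
  A-ofLength 1 refl = refl
  A-ofLength 2 refl = refl
  A-ofLength (suc (suc (suc n))) (i , w∈) = OfLength-Blocks i (A-ofLength (suc (suc n))) (A-ofLength (suc n)) w∈

  A-finite : ∀ n → Finite (A m n)
  A-finite 0 = Finite-∅
  A-finite 1 = Finite-singleton (0b ∷ [])
  A-finite 2 = Finite-singleton (1b ∷ [])
  A-finite (suc (suc (suc n))) = Finite-⋃ (suc m) λ i → Finite-∏ (suc m)
    (Finite-Blocks (A-finite (suc (suc n))) (A-finite (suc n)) i)

  a : ℕ → ℕ
  a n = card (A-finite n)

  a-upper : ∀ n → a (3 + n) ≤ suc m * (a (2 + n) ^ m * a (1 + n))
  a-upper n = card≤Cover (A-finite (3 + n)) (Cover-⋃ (suc m) λ i →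
    Cover-Blocks i (Finite⇒Cover (A-finite (2 + n))) (Finite⇒Cover (A-finite (1 + n))))

  A-last : ∀ n → A m (2 + n) ^· m · A m (1 + n) ⊆ A m (3 + n)
  A-last n w∈ = fromℕ m , Blocks-last m w∈

  -- Of the m + 1 sets in the union only the one with i = m is counted; its factors have fixed
  -- lengths, so no two choices coincide.
  a-lower : ∀ n → a (2 + n) ^ m * a (1 + n) ≤ a (3 + n)
  a-lower n = Packing≤card (A-finite (3 + n)) (Packing-mono (A-last n)
    (Packing-· (OfLength-^· m (A-ofLength (2 + n)))
      (Packing-^· m (A-ofLength (2 + n)) (Finite⇒Packing (A-finite (2 + n))))
      (Finite⇒Packing (A-finite (1 + n)))))

  A-inhabited : ∀ n → ∃[ w ] w ∈ A m (suc n)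
  A-inhabited 0 = _ , refl
  A-inhabited 1 = _ , refl
  A-inhabited (suc (suc n)) with ^·-inhabited (proj₂ (A-inhabited (suc n))) m | A-inhabited n
  ... | u , u∈ | v , v∈ = u ++ v , A-last n (u , v , u∈ , v∈ , refl)

  a>0 : ∀ n → 0 < a (suc n)
  a>0 n = Packing≤card (A-finite (suc n)) (Packing-mono (λ { refl → proj₂ (A-inhabited n) }) (Packing-singleton _))

  l>0 : ∀ n → 0 < l m (suc n)
  l>0 0             = s≤s z≤n
  l>0 1             = s≤s z≤n
  l>0 (suc (suc n)) = ≤-trans (l>0 n) (m≤n+m _ _)

module Inflation (m′ : ℕ) where

  m : ℕ
  m = suc m′

  l-mono-suc : ∀ n → l m n ≤ l m (suc n)
  l-mono-suc 0             = z≤n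
  l-mono-suc 1             = s≤s z≤n
  l-mono-suc (suc (suc n)) = ≤-trans (m≤m+n _ _) (m≤m+n _ (l m (suc n)))

  l-mono : ∀ {i j} → i ≤ j → l m i ≤ l m j
  l-mono {j = zero}  z≤n = z≤n
  l-mono {j = suc j} i≤ with m≤n⇒m<n∨m≡n i≤
  ... | inj₁ (s≤s i≤j) = ≤-trans (l-mono i≤j) (l-mono-suc j)
  ... | inj₂ refl      = ≤-refl

  l-suc-≤ : ∀ n → l m (2 + n) ≤ suc m * l m (1 + n)
  l-suc-≤ zero    = s≤s z≤n
  l-suc-≤ (suc n) = subst (l m (3 + n) ≤_) (+-comm (m * l m (2 + n)) _)
    (+-monoʳ-≤ (m * l m (2 + n)) (l-mono-suc (1 + n)))

  n≤l : ∀ n → n ≤ l m (suc n)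
  n≤l 0             = z≤n
  n≤l 1             = s≤s z≤n
  n≤l (suc (suc n)) = ≤-trans (≤-reflexive (+-comm 1 (suc n)))
    (+-mono-≤ (≤-trans (n≤l (suc n)) (m≤m+n _ _)) (l>0 m n))

  Block : ℕ → WordSet
  Block n = A m (1 + n) ∪ A m (2 + n)

  -- The block from `A m (1 + n)` is placed last, i = m, so that u v ends the word; `A-extendʳ`
  -- places it second, i = 1, so that u v begins the word.
  A-extendˡ : ∀ n u v → u ∈ A m (2 + n) → v ∈ A m (1 + n) → ∃[ p ] p ++ (u ++ v) ∈ A m (3 + n)
  A-extendˡ n u v u∈ v∈ with ^·-inhabited u∈ m′
  ... | us , us∈ = us , A-last m n (us ++ u , v , ^·-snoc m′ (us , u , us∈ , u∈ , refl) , v∈ , sym (++-assoc us u v))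

  A-extendʳ : ∀ n u v → u ∈ A m (2 + n) → v ∈ A m (1 + n) → ∃[ s ] u ++ (v ++ s) ∈ A m (3 + n)
  A-extendʳ n u v u∈ v∈ with ^·-inhabited u∈ m′
  ... | us , us∈ = us , suc zero , u , v ++ us , u∈ , (v , us , v∈ , ^·⇒∏-const m′ us∈ , refl) , refl

  Block-prefix : ∀ n {u} → u ∈ Block n → ∃[ s ] u ++ s ∈ A m (3 + n)
  Block-prefix n {u} (inj₁ u∈) with ^·-inhabited (proj₂ (A-inhabited m (suc n))) m
  ... | us , us∈ = us , zero , u , us , u∈ , ^·⇒∏-const m us∈ , refl
  Block-prefix n {u} (inj₂ u∈) with A-extendʳ n u (proj₁ (A-inhabited m n)) u∈ (proj₂ (A-inhabited m n))
  ... | s , w∈ = _ , w∈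

  Block-suffix : ∀ n {u} → u ∈ Block n → ∃[ p ] p ++ u ∈ A m (3 + n)
  Block-suffix n {u} (inj₁ u∈) with A-inhabited m (suc n)
  ... | v , v∈ with A-extendˡ n v u v∈ u∈
  ... | p , w∈ = p ++ v , subst (_∈ A m (3 + n)) (sym (++-assoc p v u)) w∈
  Block-suffix n {u} (inj₂ u∈) with A-inhabited m n | ^·-inhabited u∈ m′
  ... | v , v∈ | us , us∈ = v ++ us , zero , v , us ++ u , v∈ ,
    ^·⇒∏-const m (^·-snoc m′ (us , u , us∈ , u∈ , refl)) , ++-assoc v us u

  -- `A-extendˡ` joins words of consecutive levels, so the two sides are raised unequally: u becomes
  -- a suffix at level 3 + n and then at 4 + n, while v becomes a prefix at level 3 + n.
  Block-pair : ∀ n {u v} → u ∈ Block n → v ∈ Block n → ∃[ z ] z ∈ A m (5 + n) × u ++ v ⊑ z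
  Block-pair n {u} {v} u∈ v∈ with Block-suffix n u∈ | Block-prefix n v∈
  ... | p , pu∈ | s , vs∈ with Block-suffix (suc n) (inj₂ pu∈)
  ... | q , qpu∈ with A-extendˡ (suc (suc n)) (q ++ (p ++ u)) (v ++ s) qpu∈ vs∈
  ... | r , z∈ = _ , z∈ , ⊑-trans (p , s , refl) (⊑-trans (⊑-++ˡ q) (⊑-trans
    (⊑-reflexive (trans (cong (q ++_) (trans (cong (p ++_) (++-assoc u v s)) (sym (++-assoc p u (v ++ s))))) (sym (++-assoc q (p ++ u) (v ++ s)))))
    (⊑-++ˡ r)))
    where
    ⊑-reflexive : ∀ {x y} → x ≡ y → x ⊑ y
    ⊑-reflexive {x} refl = [] , [] , sym (++-identityʳ x)

  -- Words of Aₙ inside words of A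

  -- The condition defining `A∞`, cut off at level n: an invariant of finite words that survives the
  -- passage to an infinite limit.
  Good : ℕ → WordSet
  Good n w = w ∈ A m n × ∀ j → 3 ≤ j → j ≤ n → take (l m j ∸ 1) w ∈ A m j ⟦ 1 , l m j ∸ 1 ⟧

  -- The conditions up to level n only see letters of u and are inherited; the one at level n + 1 is
  -- witnessed by the new word itself.
  Good-extend : ∀ {n u v} → Good n u → u ++ v ∈ A m (suc n) → Good (suc n) (u ++ v)
  Good-extend {n} {u} {v} (u∈ , pre) w∈ = w∈ , pre′
    where
    pre′ : ∀ j → 3 ≤ j → j ≤ suc n → take (l m j ∸ 1) (u ++ v) ∈ A m j ⟦ 1 , l m j ∸ 1 ⟧
    pre′ j 3≤j j≤ with m≤n⇒m<n∨m≡n j≤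
    ... | inj₂ refl      = u ++ v , w∈ , refl
    ... | inj₁ (s≤s j≤n) = subst (_∈ A m j ⟦ 1 , l m j ∸ 1 ⟧)
      (sym (take-++ (l m j ∸ 1) u (≤-trans (m∸n≤m _ 1) (≤-trans (l-mono j≤n) (≤-reflexive (sym (A-ofLength m n u∈)))))))
      (pre j 3≤j j≤n)

  Good-next : ∀ n {u} → Good (2 + n) u → ∃[ v ] Good (3 + n) (u ++ v)
  Good-next n g with Block-prefix n (inj₂ (proj₁ g))
  ... | v , w∈ = v , Good-extend g w∈

  Good-inhabited : ∀ n → ∃[ w ] Good (2 + n) w
  Good-inhabited zero    = _ , refl , λ { _ (s≤s (s≤s (s≤s _))) (s≤s (s≤s ())) }
  Good-inhabited (suc n) = _ , proj₂ (Good-next n (proj₂ (Good-inhabited n)))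

  -- w is inserted after a good word of the next level, whose prefix conditions the whole word
  -- inherits.
  Good-contains : ∀ n {w} → w ∈ A m (suc n) → ∃[ z ] Good (3 + n) z × w ⊑ z
  Good-contains n {w} w∈ with Good-inhabited n
  ... | u , g with A-extendʳ n u w (proj₁ g) w∈
  ... | s , z∈ = _ , Good-extend g z∈ , u , s , refl

  -- The padding makes letter access total; comparisons concern only positions below the length.
  at : Word → InfiniteWord
  at w = w ⧺ const 0b

  at-++ : ∀ u {v i} → i < length u → at (u ++ v) i ≡ at u i
  at-++ (c ∷ u) {i = zero}  _       = refl
  at-++ (c ∷ u) {i = suc i} (s≤s p) = at-++ u p

  applyUpTo-at : ∀ (x : InfiniteWord) k w → k ≤ length w → (∀ i → i < k → x i ≡ at w i) → applyUpTo x k ≡ take k w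
  applyUpTo-at x zero    w       _       _ = refl
  applyUpTo-at x (suc k) (c ∷ w) (s≤s p) q =
    cong₂ _∷_ (q 0 (s≤s z≤n)) (applyUpTo-at (x ∘ suc) k w p (λ i i<k → q (suc i) (s≤s i<k)))

  ⧺-agree : ∀ (x : InfiniteWord) w → (∀ i → i < length w → x i ≡ at w i) → x ≗ w ⧺ (λ i → x (length w + i))
  ⧺-agree x []      p i       = refl
  ⧺-agree x (c ∷ w) p zero    = p 0 (s≤s z≤n)
  ⧺-agree x (c ∷ w) p (suc i) = ⧺-agree (x ∘ suc) w (λ j j< → p (suc j) (s≤s j<)) i

  ⧺-assoc : ∀ u v x → (u ++ v) ⧺ x ≗ u ⧺ (v ⧺ x)
  ⧺-assoc []      v x i       = refl
  ⧺-assoc (c ∷ u) v x zero    = refl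
  ⧺-assoc (c ∷ u) v x (suc i) = ⧺-assoc u v x i

  ⧺-cong : ∀ u {x y} → x ≗ y → u ⧺ x ≗ u ⧺ y
  ⧺-cong []      p i       = p i
  ⧺-cong (c ∷ u) p zero    = refl
  ⧺-cong (c ∷ u) p (suc i) = ⧺-cong u p i

  applyUpTo-⧺ : ∀ (x : InfiniteWord) w {y} → x ≗ w ⧺ y → applyUpTo x (length w) ≡ w
  applyUpTo-⧺ x []      p = refl
  applyUpTo-⧺ x (c ∷ w) p = cong₂ _∷_ (p 0) (applyUpTo-⧺ (x ∘ suc) w (p ∘ suc))

  take-applyUpTo : ∀ (x : InfiniteWord) {j k} → j ≤ k → take j (applyUpTo x k) ≡ applyUpTo x j
  take-applyUpTo x z≤n     = refl
  take-applyUpTo x (s≤s p) = cong (x 0 ∷_) (take-applyUpTo (x ∘ suc) p)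

  module Limit (n : ℕ) (w₀ : Word) (g₀ : Good (2 + n) w₀) where

    chain : ∀ i → ∃[ w ] Good (2 + (i + n)) w
    chain zero    = w₀ , g₀
    chain (suc i) = _ , proj₂ (Good-next (i + n) (proj₂ (chain i)))

    stage : ℕ → Word
    stage i = proj₁ (chain i)

    stage-length : ∀ i → length (stage i) ≡ l m (2 + (i + n))
    stage-length i = A-ofLength m (2 + (i + n)) (proj₁ (proj₂ (chain i)))

    -- Diagonal reading: stage i has more than i letters, and all later stages extend it.
    limit : InfiniteWord
    limit i = at (stage i) i

    stage-+ : ∀ d i {j} → j < length (stage i) → at (stage (d + i)) j ≡ at (stage i) j
    stage-+ zero    i p = refl
    stage-+ (suc d) i {j} p = trans (at-++ (stage (d + i)) j<) (stage-+ d i p)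
      where
      j< : j < length (stage (d + i))
      j< = ≤-trans p (subst₂ _≤_ (sym (stage-length i)) (sym (stage-length (d + i)))
             (l-mono (+-monoʳ-≤ 2 (+-monoˡ-≤ n (m≤n+m i d)))))

    stage-agree : ∀ {i i′ j} → j < length (stage i) → j < length (stage i′) → at (stage i) j ≡ at (stage i′) j
    stage-agree {i} {i′} {j} p q with ≤-total i i′
    ... | inj₁ i≤ = sym (subst (λ t → at (stage t) j ≡ at (stage i) j) (m∸n+n≡m i≤) (stage-+ (i′ ∸ i) i p))
    ... | inj₂ ≤i = subst (λ t → at (stage t) j ≡ at (stage i′) j) (m∸n+n≡m ≤i) (stage-+ (i ∸ i′) i′ q)

    i<stage : ∀ i → i < length (stage i)
    i<stage i = ≤-trans (s≤s (m≤m+n i n)) (≤-trans (n≤l (suc (i + n))) (≤-reflexive (sym (stage-length i))))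

    limit-agree : ∀ i j → j < length (stage i) → limit j ≡ at (stage i) j
    limit-agree i j p = stage-agree {j} {i} (i<stage j) p

    limit∈A∞ : A∞ m limit
    limit∈A∞ k 3≤k = subst (_∈ A m k ⟦ 1 , l m k ∸ 1 ⟧)
      (sym (applyUpTo-at limit (l m k ∸ 1) (stage k) short
        λ i i< → limit-agree k i (≤-trans i< short)))
      (proj₂ (proj₂ (chain k)) k 3≤k k≤)
      where
      k≤ : k ≤ 2 + (k + n)
      k≤ = ≤-trans (m≤m+n k n) (m≤n+m (k + n) 2)
      short : l m k ∸ 1 ≤ length (stage k)
      short = ≤-trans (m∸n≤m _ 1) (≤-trans (l-mono k≤) (≤-reflexive (sym (stage-length k))))

    limit-factor : ∀ {x} → x ⊑ w₀ → x ∈ FactorOf limit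
    limit-factor {x} (p , s , refl) = p , s ⧺ rest , λ i → trans (⧺-agree limit w₀ (limit-agree 0) i)
      (trans (⧺-assoc p (x ++ s) rest i) (⧺-cong p (⧺-assoc x s rest) i))
      where
      rest : InfiniteWord
      rest i = limit (length w₀ + i)

  A⇒F : ∀ n {x z} → z ∈ A m (suc n) → x ⊑ z → x ∈ F (A∞ m) (length x)
  A⇒F n z∈ x⊑ with Good-contains n z∈
  ... | w , g , z⊑ = refl , limit , limit∈A∞ , limit-factor (⊑-trans x⊑ z⊑)
    where open Limit (suc n) w g

  -- The prefix of length `l m n ∸ 1` has to cover u x, and n has to exceed k so that z can be cut
  -- into blocks of level k. This is why n is the length of u x plus k + 3.
  F⇒A : ∀ k {N x} → x ∈ F (A∞ m) N → ∃[ d ] ∃[ z ] z ∈ A m (suc (d + k)) × x ⊑ z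
  F⇒A k {x = x} (refl , w , w∈A∞ , u , v , w≗) with w∈A∞ n (s≤s (s≤s (s≤s z≤n)))
    where n = suc (suc (suc (length (u ++ x)) + k))
  ... | z , z∈ , e = suc (suc (length (u ++ x))) , z , z∈ , u , drop (length (u ++ x)) z ,
    trans (sym (take++drop≡id (length (u ++ x)) z)) (trans (cong (_++ drop (length (u ++ x)) z) prefix) (++-assoc u x _))
    where
    n = suc (suc (suc (length (u ++ x)) + k))
    long : length (u ++ x) ≤ l m n ∸ 1
    long = ∸-monoˡ-≤ {suc (length (u ++ x))} 1 (≤-trans (≤-trans (m≤m+n _ k) (n≤1+n _)) (n≤l _))
    prefix : take (length (u ++ x)) z ≡ u ++ x
    prefix = begin
      take (length (u ++ x)) z                        ≡⟨ cong (λ t → take t z) (m≤n⇒m⊓n≡m long) ⟨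
      take (length (u ++ x) ⊓ (l m n ∸ 1)) z          ≡⟨ take-take (length (u ++ x)) (l m n ∸ 1) z ⟨
      take (length (u ++ x)) (take (l m n ∸ 1) z)     ≡⟨ cong (take (length (u ++ x))) e ⟨
      take (length (u ++ x)) (applyUpTo w (l m n ∸ 1)) ≡⟨ take-applyUpTo w long ⟩
      applyUpTo w (length (u ++ x))
        ≡⟨ applyUpTo-⧺ w (u ++ x) (λ i → trans (w≗ i) (sym (⧺-assoc u x v i))) ⟩
      u ++ x ∎
      where open ≡-Reasoning

-- Tilings by inflated words

Factors : ℕ → WordSet → WordSet
Factors N W x = length x ≡ N × ∃[ z ] z ∈ W × x ⊑ z

Finite-Factors : ∀ {W} N → Finite W → Finite (Factors N W)
Finite-Factors {W} N fin = enumerated⇒Finite (concatMap windows elements) windows-sound windows-complete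
  where
  open Finite fin
  window : Word → ℕ → Word
  window z i = take N (drop i z)
  windows : Word → List Word
  -- Windows that run over the end of z are too short and are filtered out.
  windows z = filter (λ x → length x ≟ N) (map (window z) (upTo (suc (length z))))
  windows-sound : ∀ {x} → x ∈ˡ concatMap windows elements → x ∈ Factors N W
  windows-sound x∈ with find (∈-concatMap⁻ windows {xs = elements} x∈)
  ... | z , z∈ , x∈z with ∈-filter⁻ (λ x → length x ≟ N) {xs = map (window z) (upTo (suc (length z)))} x∈z
  ... | x∈map , len with ∈-map⁻ (window z) {xs = upTo (suc (length z))} x∈map
  ... | i , _ , refl = len , z , sound z∈ , take i z , drop N (drop i z) ,
    sym (trans (cong (take i z ++_) (take++drop≡id N (drop i z))) (take++drop≡id i z))
  windows-complete : ∀ {x} → x ∈ Factors N W → x ∈ˡ concatMap windows elements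
  windows-complete {x} (len , z , z∈ , p , s , refl) = ∈-concatMap⁺ windows (lose (complete z∈)
    (∈-filter⁺ (λ x → length x ≟ N)
      (subst (_∈ˡ map (window (p ++ (x ++ s))) (upTo (suc (length (p ++ (x ++ s)))))) (window-≡ p x len)
        (∈-map⁺ (window (p ++ (x ++ s))) (∈-upTo⁺ (s≤s (length-++-≤ˡ p)))))
      len))
    where
    window-≡ : ∀ p x {s} → length x ≡ N → take N (drop (length p) (p ++ (x ++ s))) ≡ x
    window-≡ (_ ∷ p) x       len  = window-≡ p x len
    window-≡ []      x {s} refl = trans (take-++ (length x) x ≤-refl) (take-all (length x) x ≤-refl)

-- Because the continuation t is arbitrary, the property passes through products without splitting
-- any tiling; t = [] then gives a tiling of the word alone.
Absorbed : WordSet → WordSet → Set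
Absorbed T W = ∀ w t → w ∈ W → t ∈ T → w ++ t ∈ T

Absorbed-∏ : ∀ {T} n {V : Vector WordSet n} → (∀ i → Absorbed T (V i)) → Absorbed T (∏ V)
Absorbed-∏ zero    p _ t refl t∈ = t∈
Absorbed-∏ {T} (suc n) p _ t (u , v , u∈ , v∈ , refl) t∈ =
  subst (_∈ T) (sym (++-assoc u v t)) (p zero u (v ++ t) u∈ (Absorbed-∏ n (p ∘ suc) v t v∈ t∈))

Absorbed-Blocks : ∀ {T U V n} → Absorbed T U → Absorbed T V → ∀ (i j : Fin n) → Absorbed T (Blocks U V i j)
Absorbed-Blocks p q i j with does (i ≟ᶠ j)
... | true  = q
... | false = p

take-++-take : ∀ {j k} (q r : Word) → j ≤ k → take j (q ++ take k r) ≡ take j (q ++ r)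
take-++-take {j} {k} []      r p = trans (take-take j k r) (cong (λ i → take i r) (m≤n⇒m⊓n≡m p))
take-++-take {zero}  (_ ∷ q) r p = refl
take-++-take {suc j} (c ∷ q) r p = cong (c ∷_) (take-++-take q r (≤-trans (n≤1+n j) p))

module Tilings (m′ : ℕ) where
  open Inflation m′

  data Tiling (k : ℕ) : WordSet where
    empty : Tiling k []
    tile  : ∀ {u t} → u ∈ Block k → Tiling k t → Tiling k (u ++ t)

  Tiling-++ : ∀ {k u v} → Tiling k u → Tiling k v → Tiling k (u ++ v)
  Tiling-++         empty                  tv = tv
  Tiling-++ {k} {v = v} (tile {u} {t} u∈ tt) tv = subst (Tiling k) (sym (++-assoc u t v)) (tile u∈ (Tiling-++ tt tv))

  Block-inhabited : ∀ k → ∃[ u ] u ∈ Block k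
  Block-inhabited k = _ , inj₁ (proj₂ (A-inhabited m k))

  Block-length-≤ : ∀ k {u} → u ∈ Block k → length u ≤ l m (2 + k)
  Block-length-≤ k (inj₁ u∈) = ≤-trans (≤-reflexive (A-ofLength m (1 + k) u∈)) (l-mono-suc (1 + k))
  Block-length-≤ k (inj₂ u∈) = ≤-reflexive (A-ofLength m (2 + k) u∈)

  Block-length-≥ : ∀ k {u} → u ∈ Block k → l m (1 + k) ≤ length u
  Block-length-≥ k (inj₁ u∈) = ≤-reflexive (sym (A-ofLength m (1 + k) u∈))
  Block-length-≥ k (inj₂ u∈) = ≤-trans (l-mono-suc (1 + k)) (≤-reflexive (sym (A-ofLength m (2 + k) u∈)))

  Tiling-long : ∀ k N → ∃[ w ] Tiling k w × N ≤ length w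
  Tiling-long k zero    = [] , empty , z≤n
  Tiling-long k (suc N) with Tiling-long k N | Block-inhabited k
  ... | w , tw , N≤ | u , u∈ = u ++ w , tile u∈ tw , ≤-trans
    (+-mono-≤ (≤-trans (l>0 m k) (Block-length-≥ k u∈)) N≤) (≤-reflexive (sym (length-++ u)))

  A-absorbed : ∀ k d → Absorbed (Tiling k) (A m (suc (d + k)))
  A-absorbed k zero          _ _ u∈ t∈ = tile (inj₁ u∈) t∈
  A-absorbed k (suc zero)    _ _ u∈ t∈ = tile (inj₂ u∈) t∈
  A-absorbed k (suc (suc d)) u t (i , u∈) t∈ = Absorbed-∏ (suc m)
    (Absorbed-Blocks (A-absorbed k (suc d)) (A-absorbed k d) i) u t u∈ t∈

  A⇒Tiling : ∀ k d {w} → w ∈ A m (suc (d + k)) → Tiling k w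
  A⇒Tiling k d {w} w∈ = subst (Tiling k) (++-identityʳ w) (A-absorbed k d w [] w∈ empty)

  -- The cut after p goes through at most one tile; q is what remains of it.
  Tiling-suffix : ∀ k p {w y} → Tiling k w → w ≡ p ++ y → ∃₂ λ q r → y ≡ q ++ r × length q ≤ l m (2 + k) × Tiling k r
  Tiling-suffix k p {y = y} empty e = [] , [] , ++-conicalʳ p y (sym e) , z≤n , empty
  Tiling-suffix k p (tile {u} {t} u∈ tt) e with ≤-total (length u) (length p)
  ... | inj₁ u≤p with ++-split u p u≤p e
  ...   | s , refl , e′ = Tiling-suffix k s tt e′
  Tiling-suffix k p (tile {u} {t} u∈ tt) e | inj₂ p≤u with ++-split p u p≤u (sym e)
  ...   | s , refl , e′ = s , t , e′ , ≤-trans (length-++-≤ʳ s {p}) (Block-length-≤ k u∈) , tt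

  -- The window is no longer than the shortest block, so it meets at most two consecutive tiles. At
  -- the end of the tiling a missing tile is replaced by some block.
  Tiling-window : ∀ k p {w x s} → length x ≤ l m (1 + k) → Tiling k w → w ≡ p ++ (x ++ s) →
                  ∃[ z ] z ∈ Block k · Block k × x ⊑ z
  Tiling-window k p {x = x} {s} _ empty e with Block-inhabited k
  ... | u , u∈ = u ++ u , (u , u , u∈ , u∈ , refl) ,
    subst (_⊑ u ++ u) (sym (++-conicalˡ x s (++-conicalʳ p (x ++ s) (sym e)))) ([] , u ++ u , refl)
  Tiling-window k p x≤ (tile {u} u∈ tt) e with ≤-total (length u) (length p)
  ... | inj₁ u≤p with ++-split u p u≤p e
  ...   | q , refl , e′ = Tiling-window k q x≤ tt e′
  Tiling-window k p {x = x} {s} x≤ (tile {u} u∈ tt) e | inj₂ p≤u with ++-split p u p≤u (sym e)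
  Tiling-window k p {x = x} {s} x≤ (tile {u} u∈ empty) e | inj₂ p≤u | q , refl , e′ =
    u ++ u , (u , u , u∈ , u∈ , refl) , ⊑-trans (p , s , cong (p ++_) (trans (sym (++-identityʳ q)) (sym e′))) (⊑-++ʳ u)
  Tiling-window k p {x = x} {s} x≤ (tile {u} u∈ (tile {v} {t} v∈ _)) e | inj₂ p≤u | q , refl , e′
    with ++-split x (q ++ v) (≤-trans x≤ (≤-trans (Block-length-≥ k v∈) (length-++-≤ʳ v {q}))) (trans e′ (sym (++-assoc q v t)))
  ... | r , qv≡ , _ = u ++ v , (u , v , u∈ , v∈ , refl) , p , r , trans (++-assoc p q v) (cong (p ++_) qv≡)

  -- Blocks of level N have at least N letters, so a factor of length N lies in a product of two of
  -- them; conversely `Block-pair` realises every such product inside an inflated word. The search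
  -- through infinite words thus becomes a finite one.
  F-finite : ∀ N → Finite (F (A∞ m) N)
  F-finite N = Finite-resp sound complete (Finite-Factors N (Finite-· block block))
    where
    block : Finite (Block N)
    block = Finite-∪ (A-finite m (1 + N)) (A-finite m (2 + N))
    sound : Factors N (Block N · Block N) ⊆ F (A∞ m) N
    sound (refl , z , (u , v , u∈ , v∈ , refl) , x⊑z) with Block-pair N u∈ v∈
    ... | y , y∈ , z⊑y = A⇒F (4 + N) y∈ (⊑-trans x⊑z z⊑y)
    complete : F (A∞ m) N ⊆ Factors N (Block N · Block N)
    complete x∈ with F⇒A N x∈
    ... | d , z , z∈ , p , s , e = proj₁ x∈ ,
      Tiling-window N p (≤-trans (≤-reflexive (proj₁ x∈)) (n≤l N)) (A⇒Tiling N d z∈) e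

  f : ℕ → ℕ
  f N = card (F-finite N)

  a≤f*f : ∀ n {N} → N ≤ l m (suc n) → a m (suc n) ≤ f N * f (l m (suc n) ∸ N)
  a≤f*f n {N} N≤ = card≤Cover (A-finite m (suc n)) (Cover-mono cut ≤-refl
    (Cover-· (Finite⇒Cover (F-finite N)) (Finite⇒Cover (F-finite (l m (suc n) ∸ N)))))
    where
    cut : A m (suc n) ⊆ F (A∞ m) N · F (A∞ m) (l m (suc n) ∸ N)
    cut {w} w∈ = take N w , drop N w ,
      subst (λ k → take N w ∈ F (A∞ m) k) (trans (length-take N w) (m≤n⇒m⊓n≡m (≤-trans N≤ (≤-reflexive (sym len)))))
        (A⇒F n w∈ (subst (take N w ⊑_) (take++drop≡id N w) (⊑-++ʳ (drop N w)))) ,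
      subst (λ k → drop N w ∈ F (A∞ m) k) (trans (length-drop N w) (cong (_∸ N) len))
        (A⇒F n w∈ (subst (drop N w ⊑_) (take++drop≡id N w) (⊑-++ˡ (take N w)))) ,
      sym (take++drop≡id N w)
      where
      len : length w ≡ l m (suc n)
      len = A-ofLength m (suc n) w∈

  f>0 : ∀ N → 0 < f N
  f>0 N with f N | ≤-trans (a>0 m N) (a≤f*f N (n≤l N))
  ... | suc _ | _ = s≤s z≤n

  -- The start at a tile border permits recursion on the first tile; the free end lets every length
  -- N occur.
  Prefix : ℕ → ℕ → WordSet
  Prefix k N x = length x ≡ N × ∃[ s ] Tiling k (x ++ s)

  Prefix-split : ∀ k N → l m (2 + k) ≤ N → Prefix k N ⊆
                 (A m (1 + k) · Prefix k (N ∸ l m (1 + k))) ∪ (A m (2 + k) · Prefix k (N ∸ l m (2 + k)))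
  Prefix-split k N l≤N {x} (refl , s , tiling) = go tiling refl
    where
    rest-length : ∀ u {y i} → length u ≡ i → length y ≡ length (u ++ y) ∸ i
    rest-length u {y} refl = sym (trans (cong (_∸ length u) (length-++ u)) (m+n∸m≡n (length u) (length y)))
    go : ∀ {w} → Tiling k w → w ≡ x ++ s →
         x ∈ (A m (1 + k) · Prefix k (length x ∸ l m (1 + k))) ∪ (A m (2 + k) · Prefix k (length x ∸ l m (2 + k)))
    go empty e with ++-conicalˡ x s (sym e)
    ... | refl with ≤-trans (l>0 m (suc k)) l≤N
    ...   | ()
    go (tile {u} {t} u∈ tt) e with ++-split u x (≤-trans (Block-length-≤ k u∈) l≤N) e
    go (tile {u} {t} (inj₁ u∈) tt) e | y , refl , refl = inj₁
      (u , y , u∈ , (rest-length u (A-ofLength m (1 + k) u∈) , s , tt) , refl)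
    go (tile {u} {t} (inj₂ u∈) tt) e | y , refl , refl = inj₂
      (u , y , u∈ , (rest-length u (A-ofLength m (2 + k) u∈) , s , tt) , refl)

  -- The remainder q of the cut tile has unknown length, so the tiling behind it is prolonged to N
  -- letters and the excess removed by `take N`. The words y are then counted at the single length
  -- N, and q costs a factor independent of N.
  F⇒Prefix : ∀ k N {x} → x ∈ F (A∞ m) N →
             ∃₂ λ q y → length q ≤ l m (2 + k) × y ∈ Prefix k N × x ≡ take N (q ++ y)
  F⇒Prefix k N {x} x∈@(refl , _) with F⇒A k x∈
  ... | d , z , z∈ , p , s , e with Tiling-suffix k p (A⇒Tiling k d z∈) e
  ... | q , r , e′ , q≤ , tr with Tiling-long k N
  ... | w , tw , N≤ = q , take N (r ++ w) , q≤ ,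
    (trans (length-take N (r ++ w)) (m≤n⇒m⊓n≡m (≤-trans N≤ (length-++-≤ʳ w {r}))) , drop N (r ++ w) ,
      subst (Tiling k) (sym (take++drop≡id N (r ++ w))) (Tiling-++ tr tw)) ,
    sym (begin
      take N (q ++ take N (r ++ w)) ≡⟨ take-++-take q (r ++ w) ≤-refl ⟩
      take N (q ++ (r ++ w))
        ≡⟨ cong (take N) (trans (sym (++-assoc q r w)) (trans (cong (_++ w) (sym e′)) (++-assoc x s w))) ⟩
      take N (x ++ (s ++ w))        ≡⟨ take-++ N x ≤-refl ⟩
      take N x                      ≡⟨ take-all N x ≤-refl ⟩
      x                             ∎)
    where open ≡-Reasoning

  Short : ℕ → WordSet
  Short L w = length w ≤ L

  Short-Cover : ∀ L → ∃[ c ] Cover (Short L) c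
  Short-Cover zero    = 1 , Cover-mono (λ { {[]} _ → refl }) ≤-refl (Cover-singleton [])
  Short-Cover (suc L) = _ , Cover-mono (λ p → [ (λ { (s≤s q) → inj₁ q }) , inj₂ ]′ (m≤n⇒m<n∨m≡n p)) ≤-refl
    (Cover-∪ (proj₂ (Short-Cover L)) (AllWords-Cover (suc L)))

  F-Cover : ∀ k N {c d} → Cover (Short (l m (2 + k))) d → Cover (Prefix k N) c → Cover (F (A∞ m) N) (d * c)
  F-Cover k N (cover qs covQ szQ) (cover ys covY szY) =
    cover (map (take N) (cartesianProductWith _++_ qs ys)) covers
      (≤-trans (≤-reflexive (trans (length-map (take N) (cartesianProductWith _++_ qs ys)) (length-product qs ys))) (*-mono-≤ szQ szY))
    where
    covers : ∀ {x} → x ∈ F (A∞ m) N → x ∈ˡ map (take N) (cartesianProductWith _++_ qs ys)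
    covers {x} x∈ with F⇒Prefix k N {x} x∈
    ... | q , y , q≤ , y∈ , refl = ∈-map⁺ (take N) (∈-cartesianProductWith⁺ _++_ (covQ q≤) (covY y∈))

-- Growth of |Aₙ| and |F(A,N)|

^-distribʳ-* : ∀ x y n → (x * y) ^ n ≡ x ^ n * y ^ n
^-distribʳ-* x y zero    = refl
^-distribʳ-* x y (suc n) = trans (cong ((x * y) *_) (^-distribʳ-* x y n))
  (let open ℕ-Solver in solve 4 (λ x y p q → (x :* y) :* (p :* q) := (x :* p) :* (y :* q)) refl x y (x ^ n) (y ^ n))

^-swap : ∀ x i j → (x ^ i) ^ j ≡ (x ^ j) ^ i
^-swap x i j = trans (^-*-assoc x i j) (trans (cong (x ^_) (*-comm i j)) (sym (^-*-assoc x j i)))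

1≤^ : ∀ {x} n → 1 ≤ x → 1 ≤ x ^ n
1≤^ {suc x} n _ = m^n>0 (suc x) n

^-monoʳ : ∀ {x i j} → 1 ≤ x → i ≤ j → x ^ i ≤ x ^ j
^-monoʳ {suc x} _ p = ^-monoʳ-≤ (suc x) p

m≤m^n : ∀ {x} n → 1 ≤ x → 1 ≤ n → x ≤ x ^ n
m≤m^n {x} (suc n) 1≤x _ = ≤-trans (≤-reflexive (sym (*-identityʳ x))) (*-monoʳ-≤ x (1≤^ n 1≤x))

m≤m*n₁ : ∀ x {y} → 1 ≤ y → x ≤ x * y
m≤m*n₁ x p = ≤-trans (≤-reflexive (sym (*-identityʳ x))) (*-monoʳ-≤ x p)

m≤n*m₁ : ∀ x {y} → 1 ≤ y → x ≤ y * x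
m≤n*m₁ x {y} p = ≤-trans (m≤m*n₁ x p) (≤-reflexive (*-comm x y))

-- x + y is at most twice the larger of the two, so 2 ^ n is the price of a sum under a power.
+-^-≤ : ∀ x y n {z} → 2 ^ n * x ^ n ≤ z → 2 ^ n * y ^ n ≤ z → (x + y) ^ n ≤ z
+-^-≤ x y n {z} p q = [ (λ x≤y → bound y (+-monoˡ-≤ y x≤y) q) , (λ y≤x → bound x (+-monoʳ-≤ x y≤x) p) ]′ (≤-total x y)
  where
  bound : ∀ w → x + y ≤ w + w → 2 ^ n * w ^ n ≤ z → (x + y) ^ n ≤ z
  bound w x+y≤ r = ≤-trans (^-monoˡ-≤ n x+y≤) (≤-trans (≤-reflexive
    (trans (cong (_^ n) (cong (w +_) (sym (+-identityʳ w)))) (^-distribʳ-* 2 w n))) r)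

module Growth (m′ : ℕ) where
  open ℕ-Solver using (solve; _:=_; _:*_)
  open Inflation m′
  open Tilings m′

  b : ℕ
  b = suc m

  l₊ aₖ : ℕ → ℕ
  l₊ n = l m (suc n)
  aₖ n = a m (suc n)

  -- The exponent of b lost in `ratio` up to level k: the step from k raises the factor b of
  -- `a-upper` to the power `l₊ (suc k)`.
  e : ℕ → ℕ
  e zero    = 0
  e (suc k) = e k + l₊ (suc k)

  -- The lengths grow at least as in the Fibonacci recursion, so their sum stays comparable to the
  -- current length.
  e≤ : ∀ k → e k ≤ l₊ k + l₊ (suc k)
  e≤ zero    = z≤n
  e≤ (suc k) = begin
    e k + l₊ (suc k)                           ≤⟨ +-monoˡ-≤ (l₊ (suc k)) (e≤ k) ⟩
    (l₊ k + l₊ (suc k)) + l₊ (suc k)           ≡⟨ +-comm (l₊ k + l₊ (suc k)) (l₊ (suc k)) ⟩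
    l₊ (suc k) + (l₊ k + l₊ (suc k))           ≡⟨ cong (l₊ (suc k) +_) (+-comm (l₊ k) _) ⟩
    l₊ (suc k) + (l₊ (suc k) + l₊ k)
      ≤⟨ +-monoʳ-≤ (l₊ (suc k)) (+-monoˡ-≤ (l₊ k) (m≤m+n (l₊ (suc k)) (m′ * l₊ (suc k)))) ⟩
    l₊ (suc k) + l₊ (suc (suc k))              ∎
    where open ≤-Reasoning

  -- Consecutive values of log |Aₙ| / lₙ: with Lₙ = log |Aₙ| and Dₙ = Lₙ₊₁ lₙ − Lₙ lₙ₊₁, the recursions for Lₙ
  -- and lₙ give Dₙ₊₁ = − Dₙ + O(lₙ₊₁).
  ratio : ∀ k → aₖ (suc k) ^ l₊ k ≤ b ^ e k * aₖ k ^ l₊ (suc k)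
              × aₖ k ^ l₊ (suc k) ≤ b ^ e k * aₖ (suc k) ^ l₊ k
  ratio zero    = ≤-refl , ≤-refl
  ratio (suc k) with ratio k
  ... | up , low = up′ , low′
    where
    open ≤-Reasoning
    a₁ = aₖ k
    a₂ = aₖ (suc k)
    a₃ = aₖ (suc (suc k))
    l₁ = l₊ k
    l₂ = l₊ (suc k)
    l₃ = l₊ (suc (suc k))
    a₂^l₃ : a₂ ^ l₃ ≡ a₂ ^ (m * l₂) * a₂ ^ l₁
    a₂^l₃ = ^-distribˡ-+-* a₂ (m * l₂) l₁
    expand : (a₂ ^ m * a₁) ^ l₂ ≡ a₂ ^ (m * l₂) * a₁ ^ l₂
    expand = trans (^-distribʳ-* (a₂ ^ m) a₁ l₂) (cong (_* a₁ ^ l₂) (^-*-assoc a₂ m l₂))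
    b^e : b ^ e (suc k) ≡ b ^ e k * b ^ l₂
    b^e = ^-distribˡ-+-* b (e k) l₂
    up′ : a₃ ^ l₂ ≤ b ^ e (suc k) * a₂ ^ l₃
    up′ = begin
      a₃ ^ l₂                                           ≤⟨ ^-monoˡ-≤ l₂ (a-upper m k) ⟩
      (b * (a₂ ^ m * a₁)) ^ l₂
        ≡⟨ trans (^-distribʳ-* b (a₂ ^ m * a₁) l₂) (cong (b ^ l₂ *_) expand) ⟩
      b ^ l₂ * (a₂ ^ (m * l₂) * a₁ ^ l₂)                ≤⟨ *-monoʳ-≤ (b ^ l₂) (*-monoʳ-≤ (a₂ ^ (m * l₂)) low) ⟩
      b ^ l₂ * (a₂ ^ (m * l₂) * (b ^ e k * a₂ ^ l₁))
        ≡⟨ solve 4 (λ x y z w → x :* (y :* (z :* w)) := (z :* x) :* (y :* w)) refl (b ^ l₂) (a₂ ^ (m * l₂)) (b ^ e k) (a₂ ^ l₁) ⟩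
      (b ^ e k * b ^ l₂) * (a₂ ^ (m * l₂) * a₂ ^ l₁)    ≡⟨ cong₂ _*_ b^e a₂^l₃ ⟨
      b ^ e (suc k) * a₂ ^ l₃                           ∎
    low′ : a₂ ^ l₃ ≤ b ^ e (suc k) * a₃ ^ l₂
    low′ = begin
      a₂ ^ l₃                                    ≡⟨ a₂^l₃ ⟩
      a₂ ^ (m * l₂) * a₂ ^ l₁                    ≤⟨ *-monoʳ-≤ (a₂ ^ (m * l₂)) up ⟩
      a₂ ^ (m * l₂) * (b ^ e k * a₁ ^ l₂)
        ≡⟨ solve 3 (λ x y z → x :* (y :* z) := y :* (x :* z)) refl (a₂ ^ (m * l₂)) (b ^ e k) (a₁ ^ l₂) ⟩
      b ^ e k * (a₂ ^ (m * l₂) * a₁ ^ l₂)        ≡⟨ cong (b ^ e k *_) expand ⟨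
      b ^ e k * (a₂ ^ m * a₁) ^ l₂
        ≤⟨ *-mono-≤ (^-monoʳ (s≤s z≤n) (m≤m+n (e k) l₂)) (^-monoˡ-≤ l₂ (a-lower m k)) ⟩
      b ^ e (suc k) * a₃ ^ l₂                    ∎

  -- `B` absorbs `b ^ e k`, as e k is at most twice `l₊ (suc k)`; the further 2 in `Q` pays for the
  -- choice between two kinds of block. `Q′` carries the exponent b because the word cut in
  -- `f-lower` may have up to b N letters.
  B Q : ℕ
  B = b ^ 2
  Q = 2 * B

  Q′ : ℕ
  Q′ = (Q * B) ^ b

  1≤B : 1 ≤ B
  1≤B = 1≤^ {b} 2 (s≤s z≤n)

  b^e≤ : ∀ k → b ^ e k ≤ B ^ l₊ (suc k)
  b^e≤ k = ≤-trans (^-monoʳ (s≤s z≤n) (≤-trans (e≤ k) (≤-trans (+-monoˡ-≤ (l₊ (suc k)) (l-mono-suc (suc k)))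
      (≤-reflexive (cong (l₊ (suc k) +_) (sym (+-identityʳ _)))))))
    (≤-reflexive (sym (^-*-assoc b 2 (l₊ (suc k)))))

  -- The exponent of the error factor is the length itself, which obeys the recursion of the main
  -- term, so B does not deteriorate with d. `ratio` enters only at d = 1.
  a-growth : ∀ k d → aₖ k ^ l₊ (d + k) ≤ aₖ (d + k) ^ l₊ k * B ^ l₊ (d + k)
  a-growth k zero          = m≤m*n₁ (aₖ k ^ l₊ k) (1≤^ (l₊ k) 1≤B)
  a-growth k (suc zero)    = begin
    aₖ k ^ l₊ (suc k)                       ≤⟨ proj₂ (ratio k) ⟩
    b ^ e k * aₖ (suc k) ^ l₊ k             ≡⟨ *-comm (b ^ e k) _ ⟩
    aₖ (suc k) ^ l₊ k * b ^ e k             ≤⟨ *-monoʳ-≤ (aₖ (suc k) ^ l₊ k) (b^e≤ k) ⟩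
    aₖ (suc k) ^ l₊ k * B ^ l₊ (suc k)      ∎
    where open ≤-Reasoning
  a-growth k (suc (suc d)) = begin
    x ^ (m * l₂ + l₁)                                             ≡⟨ ^-distribˡ-+-* x (m * l₂) l₁ ⟩
    x ^ (m * l₂) * x ^ l₁                                         ≡⟨ cong (_* x ^ l₁) (power x) ⟩
    (x ^ l₂) ^ m * x ^ l₁
      ≤⟨ *-mono-≤ (^-monoˡ-≤ m (a-growth k (suc d))) (a-growth k d) ⟩
    (a₂ ^ L * B ^ l₂) ^ m * (a₁ ^ L * B ^ l₁)
      ≡⟨ cong (_* (a₁ ^ L * B ^ l₁)) (trans (^-distribʳ-* (a₂ ^ L) (B ^ l₂) m) (cong₂ _*_ (^-swap a₂ L m) (sym (power B)))) ⟩
    ((a₂ ^ m) ^ L * B ^ (m * l₂)) * (a₁ ^ L * B ^ l₁)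
      ≡⟨ solve 4 (λ x y z w → (x :* y) :* (z :* w) := (x :* z) :* (y :* w)) refl ((a₂ ^ m) ^ L) (B ^ (m * l₂)) (a₁ ^ L) (B ^ l₁) ⟩
    ((a₂ ^ m) ^ L * a₁ ^ L) * (B ^ (m * l₂) * B ^ l₁)
      ≡⟨ cong₂ _*_ (^-distribʳ-* (a₂ ^ m) a₁ L) (^-distribˡ-+-* B (m * l₂) l₁) ⟨
    (a₂ ^ m * a₁) ^ L * B ^ (m * l₂ + l₁)
      ≤⟨ *-monoˡ-≤ (B ^ (m * l₂ + l₁)) (^-monoˡ-≤ L (a-lower m (d + k))) ⟩
    aₖ (suc (suc d) + k) ^ L * B ^ (m * l₂ + l₁)                  ∎
    where
    open ≤-Reasoning
    x = aₖ k
    L = l₊ k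
    a₁ = aₖ (d + k)
    a₂ = aₖ (suc d + k)
    l₁ = l₊ (d + k)
    l₂ = l₊ (suc d + k)
    power : ∀ y → y ^ (m * l₂) ≡ (y ^ l₂) ^ m
    power y = trans (cong (y ^_) (*-comm m l₂)) (sym (^-*-assoc y l₂ m))

  module Level (k : ℕ) where
    x L L₂ K : ℕ
    x  = aₖ k
    L  = l₊ k
    L₂ = l₊ (suc k)
    -- For the base case of `Prefix-Cover`: there are at most 2 ^ L₂ words of a given length N ≤ L₂.
    K  = (2 ^ L₂) ^ L

    -- Counts c are bounded through `c ^ L`, which takes the place of the root x ^ (N / L).
    target : ℕ → ℕ
    target N = x ^ N * (Q ^ N * K)

    -- The factor 2 ^ L anticipates `+-^-≤`. It is paid from Q ^ s, which `2^≤Q^` allows because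
    -- every block has length s ≥ L.
    block-step : ∀ {N c} y s → s ≤ N → y ^ L * 2 ^ L ≤ x ^ s * Q ^ s → c ^ L ≤ target (N ∸ s) → 2 ^ L * (y * c) ^ L ≤ target N
    block-step {N} {c} y s s≤N p q = begin
      2 ^ L * (y * c) ^ L                                        ≡⟨ cong (2 ^ L *_) (^-distribʳ-* y c L) ⟩
      2 ^ L * (y ^ L * c ^ L)
        ≡⟨ solve 3 (λ x y z → x :* (y :* z) := (y :* x) :* z) refl (2 ^ L) (y ^ L) (c ^ L) ⟩
      (y ^ L * 2 ^ L) * c ^ L                                    ≤⟨ *-mono-≤ p q ⟩
      (x ^ s * Q ^ s) * target (N ∸ s)
        ≡⟨ solve 5 (λ x y z w k → (x :* y) :* (z :* (w :* k)) := (x :* z) :* ((y :* w) :* k)) refl (x ^ s) (Q ^ s) (x ^ (N ∸ s)) (Q ^ (N ∸ s)) K ⟩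
      (x ^ s * x ^ (N ∸ s)) * ((Q ^ s * Q ^ (N ∸ s)) * K)        ≡⟨ cong₂ (λ u v → u * (v * K)) (join x) (join Q) ⟩
      target N                                                   ∎
      where
      open ≤-Reasoning
      join : ∀ z → z ^ s * z ^ (N ∸ s) ≡ z ^ N
      join z = trans (sym (^-distribˡ-+-* z s (N ∸ s))) (cong (z ^_) (m+[n∸m]≡n s≤N))

    2^≤Q^ : ∀ s → L ≤ s → B ^ s * 2 ^ L ≤ Q ^ s
    2^≤Q^ s L≤s = begin
      B ^ s * 2 ^ L    ≤⟨ *-monoʳ-≤ (B ^ s) (^-monoʳ (s≤s z≤n) L≤s) ⟩
      B ^ s * 2 ^ s    ≡⟨ *-comm (B ^ s) (2 ^ s) ⟩
      2 ^ s * B ^ s    ≡⟨ ^-distribʳ-* 2 B s ⟨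
      Q ^ s            ∎
      where open ≤-Reasoning

    1≤Q : 1 ≤ Q
    1≤Q = ≤-trans 1≤B (m≤n*m₁ B {2} (s≤s z≤n))

    Prefix-Cover : ∀ N → ∃[ c ] Cover (Prefix k N) c × c ^ L ≤ target N
    Prefix-Cover = <-rec _ step
      where
      step : ∀ N → (∀ {M} → M < N → ∃[ c ] Cover (Prefix k M) c × c ^ L ≤ target M) →
             ∃[ c ] Cover (Prefix k N) c × c ^ L ≤ target N
      step N rec with ≤-total L₂ N
      ... | inj₂ N≤L₂ = 2 ^ N , Cover-mono proj₁ ≤-refl (AllWords-Cover N) ,
        ≤-trans (^-monoˡ-≤ L (^-monoʳ {2} (s≤s z≤n) N≤L₂))
          (≤-trans (m≤n*m₁ K (1≤^ N 1≤Q)) (m≤n*m₁ (Q ^ N * K) (1≤^ N (a>0 m k))))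
      ... | inj₁ L₂≤N with rec (∸-monoʳ-< {N} {L} {0} (l>0 m k) (≤-trans (l-mono-suc (suc k)) L₂≤N)) | rec (∸-monoʳ-< {N} {L₂} {0} (l>0 m (suc k)) L₂≤N)
      ... | c₁ , cov₁ , c₁≤ | c₂ , cov₂ , c₂≤ = _ , Cover-mono (Prefix-split k N L₂≤N) ≤-refl
          (Cover-∪ (Cover-· (Finite⇒Cover (A-finite m (1 + k))) cov₁) (Cover-· (Finite⇒Cover (A-finite m (2 + k))) cov₂)) ,
        +-^-≤ (x * c₁) (aₖ (suc k) * c₂) L
          (block-step x L (≤-trans (l-mono-suc (suc k)) L₂≤N) (*-monoʳ-≤ (x ^ L) (≤-trans (m≤n*m₁ (2 ^ L) (1≤^ L 1≤B)) (2^≤Q^ L ≤-refl))) c₁≤)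
          (block-step (aₖ (suc k)) L₂ L₂≤N long c₂≤)
        where
        open ≤-Reasoning
        long : aₖ (suc k) ^ L * 2 ^ L ≤ x ^ L₂ * Q ^ L₂
        long = begin
          aₖ (suc k) ^ L * 2 ^ L            ≤⟨ *-monoˡ-≤ (2 ^ L) (proj₁ (ratio k)) ⟩
          (b ^ e k * x ^ L₂) * 2 ^ L        ≤⟨ *-monoˡ-≤ (2 ^ L) (*-monoˡ-≤ (x ^ L₂) (b^e≤ k)) ⟩
          (B ^ L₂ * x ^ L₂) * 2 ^ L
            ≡⟨ solve 3 (λ x y z → (x :* y) :* z := y :* (x :* z)) refl (B ^ L₂) (x ^ L₂) (2 ^ L) ⟩
          x ^ L₂ * (B ^ L₂ * 2 ^ L)         ≤⟨ *-monoʳ-≤ (x ^ L₂) (2^≤Q^ L₂ (l-mono-suc (suc k))) ⟩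
          x ^ L₂ * Q ^ L₂                   ∎

    f-upper : ∃[ K′ ] ∀ N → f N ^ L ≤ x ^ N * (Q ^ N * K′)
    f-upper with Short-Cover L₂
    ... | d , covd = d ^ L * K , λ N → bound N (Prefix-Cover N)
      where
      open ≤-Reasoning
      bound : ∀ N → ∃[ c ] Cover (Prefix k N) c × c ^ L ≤ target N → f N ^ L ≤ x ^ N * (Q ^ N * (d ^ L * K))
      bound N (c , cov , c≤) = begin
        f N ^ L                           ≤⟨ ^-monoˡ-≤ L (card≤Cover (F-finite N) (F-Cover k N covd cov)) ⟩
        (d * c) ^ L                       ≡⟨ ^-distribʳ-* d c L ⟩
        d ^ L * c ^ L                     ≤⟨ *-monoʳ-≤ (d ^ L) c≤ ⟩
        d ^ L * (x ^ N * (Q ^ N * K))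
          ≡⟨ solve 4 (λ d x q k → d :* (x :* (q :* k)) := x :* (q :* (d :* k))) refl (d ^ L) (x ^ N) (Q ^ N) K ⟩
        x ^ N * (Q ^ N * (d ^ L * K))     ∎

    l-between : ∀ {N} → L ≤ N → ∃[ d ] N ≤ l₊ (d + k) × l₊ (d + k) ≤ b * N
    l-between {N} L≤N with search (N + N)
      where
      search : ∀ d → l₊ (d + k) ≤ N ⊎ ∃[ d ] N ≤ l₊ (d + k) × l₊ (d + k) ≤ b * N
      search zero    = inj₁ L≤N
      search (suc d) with search d
      ... | inj₂ found = inj₂ found
      ... | inj₁ ≤N with ≤-total (l₊ (suc d + k)) N
      ...   | inj₁ ≤N′ = inj₁ ≤N′
      ...   | inj₂ N≤  = inj₂ (suc d , N≤ , ≤-trans (l-suc-≤ (d + k)) (*-monoʳ-≤ b ≤N))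
    ... | inj₂ found = found
    -- If the search never passes N, its last length is still at least N by `n≤l` and serves itself.
    ... | inj₁ ≤N    = N + N , ≤-trans (m≤m+n N N) (≤-trans (m≤m+n (N + N) k) (n≤l (N + N + k))) ,
      ≤-trans ≤N (m≤n*m₁ N {b} (s≤s z≤n))

    f-lower : ∀ K′ → (∀ N → f N ^ L ≤ x ^ N * (Q ^ N * K′)) → ∀ {N} → L ≤ N → x ^ N ≤ f N ^ L * (Q′ ^ N * K′)
    f-lower K′ upper {N} L≤N with l-between L≤N
    -- The main term x ^ r in the bound for the second piece, of r = n - N letters, cancels and
    -- leaves x ^ N.
    ... | d , N≤ , ≤bN = *-cancelʳ-≤ _ _ (x ^ r) {{>-nonZero (1≤^ r (a>0 m k))}} (begin
      x ^ N * x ^ r                                        ≡⟨ join ⟩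
      x ^ n                                                ≤⟨ a-growth k d ⟩
      aₖ (d + k) ^ L * B ^ n                               ≤⟨ *-monoˡ-≤ (B ^ n) (^-monoˡ-≤ L (a≤f*f (d + k) N≤)) ⟩
      (f N * f r) ^ L * B ^ n                              ≡⟨ cong (_* B ^ n) (^-distribʳ-* (f N) (f r) L) ⟩
      (f N ^ L * f r ^ L) * B ^ n                          ≤⟨ *-monoˡ-≤ (B ^ n) (*-monoʳ-≤ (f N ^ L) (upper r)) ⟩
      (f N ^ L * (x ^ r * (Q ^ r * K′))) * B ^ n
        ≡⟨ solve 5 (λ f x q k b → (f :* (x :* (q :* k))) :* b := (f :* ((q :* b) :* k)) :* x) refl (f N ^ L) (x ^ r) (Q ^ r) K′ (B ^ n) ⟩
      (f N ^ L * ((Q ^ r * B ^ n) * K′)) * x ^ r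
        ≤⟨ *-monoˡ-≤ (x ^ r) (*-monoʳ-≤ (f N ^ L) (*-monoˡ-≤ K′ constants)) ⟩
      (f N ^ L * (Q′ ^ N * K′)) * x ^ r                    ∎)
      where
      open ≤-Reasoning
      n = l₊ (d + k)
      r = n ∸ N
      join : x ^ N * x ^ r ≡ x ^ n
      join = trans (sym (^-distribˡ-+-* x N r)) (cong (x ^_) (m+[n∸m]≡n N≤))
      constants : Q ^ r * B ^ n ≤ Q′ ^ N
      constants = begin
        Q ^ r * B ^ n        ≤⟨ *-monoˡ-≤ (B ^ n) (^-monoʳ 1≤Q (m∸n≤m n N)) ⟩
        Q ^ n * B ^ n        ≡⟨ ^-distribʳ-* Q B n ⟨
        (Q * B) ^ n          ≤⟨ ^-monoʳ (≤-trans 1≤Q (m≤m*n₁ Q 1≤B)) ≤bN ⟩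
        (Q * B) ^ (b * N)    ≡⟨ ^-*-assoc (Q * B) b N ⟨
        Q′ ^ N               ∎

    comparison : ∃[ K′ ] ∀ N → L ≤ N → f N ^ L ≤ x ^ N * (Q′ ^ N * K′) × x ^ N ≤ f N ^ L * (Q′ ^ N * K′)
    comparison with f-upper
    ... | K′ , upper = K′ , λ N L≤N →
      ≤-trans (upper N) (*-monoʳ-≤ (x ^ N) (*-monoˡ-≤ K′ (^-monoˡ-≤ N Q≤Q′))) , f-lower K′ upper L≤N
      where
      Q≤Q′ : Q ≤ Q′
      Q≤Q′ = ≤-trans (m≤m*n₁ Q 1≤B) (m≤m^n b (≤-trans 1≤Q (m≤m*n₁ Q 1≤B)) (s≤s z≤n))

-- Logarithms

open ℤ using (+_; +[1+_]; -[1+_])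
open RationalBounds
open RiemannSums
open ℚ-Solver using (solve; _:=_; _:*_; _:+_; :-_; _:-_)

ι : ℕ → ℚ
ι n = + n ℚ./ 1

ι-+ : ∀ i j → ι (i + j) ≡ ι i ℚ.+ ι j
ι-+ i j = ℚₚ.toℚᵘ-injective (ℚᵘₚ.≃-trans (toℚᵘ-/ (+ (i + j)) 1) (ℚᵘₚ.≃-sym
  (ℚᵘₚ.≃-trans (ℚₚ.toℚᵘ-homo-+ (ι i) (ι j)) (ℚᵘₚ.≃-trans (ℚᵘₚ.+-cong (toℚᵘ-/ (+ i) 1) (toℚᵘ-/ (+ j) 1))
    (ℚᵘ.*≡* (cong (ℤ._* + 1) (cong₂ ℤ._+_ (ℤₚ.*-identityʳ (+ i)) (ℤₚ.*-identityʳ (+ j)))))))))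

ι-* : ∀ i j → ι (i * j) ≡ ι i ℚ.* ι j
ι-* i j = ℚₚ.toℚᵘ-injective (ℚᵘₚ.≃-trans (toℚᵘ-/ (+ (i * j)) 1) (ℚᵘₚ.≃-sym
  (ℚᵘₚ.≃-trans (ℚₚ.toℚᵘ-homo-* (ι i) (ι j)) (ℚᵘₚ.≃-trans (ℚᵘₚ.*-cong (toℚᵘ-/ (+ i) 1) (toℚᵘ-/ (+ j) 1))
    (ℚᵘ.*≡* (cong (ℤ._* + 1) (sym (ℤₚ.pos-* i j))))))))

ι-mono : ∀ {i j} → i ≤ j → ι i ℚ.≤ ι j
ι-mono {i} {j} p = ℚₚ.toℚᵘ-cancel-≤ (ℚᵘₚ.≤-respˡ-≃ (ℚᵘₚ.≃-sym (toℚᵘ-/ (+ i) 1))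
  (ℚᵘₚ.≤-respʳ-≃ (ℚᵘₚ.≃-sym (toℚᵘ-/ (+ j) 1)) (ℚᵘ.*≤* (ℤₚ.*-monoʳ-≤-nonNeg (+ 1) (ℤ.+≤+ p)))))

ι-nonNeg : ∀ n → 0ℚ ℚ.≤ ι n
ι-nonNeg n = ι-mono {0} {n} z≤n

ι-*-1/suc : ∀ n → ι (suc n) ℚ.* 1/suc n ≡ 1ℚ
ι-*-1/suc n = trans (sym (×/-≡ (suc n) (1/suc n))) (×/-1/suc n n 0 (sym (*-identityʳ (suc n))))

*-monoˡ : ∀ {x y z} → 0ℚ ℚ.≤ z → x ℚ.≤ y → x ℚ.* z ℚ.≤ y ℚ.* z
*-monoˡ {z = z} p = ℚₚ.*-monoʳ-≤-nonNeg z {{ℚ.nonNegative p}}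

*-monoʳ : ∀ {x y z} → 0ℚ ℚ.≤ z → x ℚ.≤ y → z ℚ.* x ℚ.≤ z ℚ.* y
*-monoʳ {z = z} p = ℚₚ.*-monoˡ-≤-nonNeg z {{ℚ.nonNegative p}}

*-nonNeg : ∀ {x y} → 0ℚ ℚ.≤ x → 0ℚ ℚ.≤ y → 0ℚ ℚ.≤ x ℚ.* y
*-nonNeg {x} {y} p q = subst (ℚ._≤ x ℚ.* y) (ℚₚ.*-zeroˡ y) (*-monoˡ q p)

x≤x+y : ∀ x {y} → 0ℚ ℚ.≤ y → x ℚ.≤ x ℚ.+ y
x≤x+y x {y} p = subst (ℚ._≤ x ℚ.+ y) (ℚₚ.+-identityʳ x) (ℚₚ.+-monoʳ-≤ x p)

riemann-mono : ∀ p {i j} → i ≤ j → riemann p i ℚ.≤ riemann p j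
riemann-mono p {i} {j} i≤j = subst (λ t → riemann p i ℚ.≤ riemann p t) (m+[n∸m]≡n i≤j)
  (subst (riemann p i ℚ.≤_) (sym (riemann-+ p i (j ∸ i))) (x≤x+y (riemann p i) (nonNeg (p + i) (j ∸ i))))
  where
  nonNeg : ∀ q n → 0ℚ ℚ.≤ riemann q n
  nonNeg q zero    = ℚₚ.≤-refl
  nonNeg q (suc n) = 0≤x+y (nonNeg q n) (1/suc-nonNeg (suc q + n))

-- The approximations of the logarithm at one fixed precision p. They are monotone, superadditive and
-- subadditive up to 1, which is all that the asymptotics needs, with bounds that are uniform in p.
module Precision (p : ℕ) where

  λₚ : ℕ → ℚ
  λₚ n = approx (ln n) p

  λ-mono : ∀ {i j} → i ≤ j → λₚ i ℚ.≤ λₚ j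
  λ-mono i≤j = riemann-mono p (*-monoˡ-≤ (suc p) (pred-mono-≤ i≤j))

  λ-nonNeg : ∀ n → 0ℚ ℚ.≤ λₚ n
  λ-nonNeg n = riemann-mono p {0} {pred n * suc p} z≤n

  λ≤ι : ∀ n → λₚ n ℚ.≤ ι n
  λ≤ι n = ℚₚ.≤-trans (riemann-upper p (pred n * suc p)) (ℚₚ.≤-trans (ℚₚ.≤-reflexive (begin
    (pred n * suc p) ×/ 1/suc p            ≡⟨ ×/-≡ (pred n * suc p) (1/suc p) ⟩
    ι (pred n * suc p) ℚ.* 1/suc p         ≡⟨ cong (ℚ._* 1/suc p) (ι-* (pred n) (suc p)) ⟩
    (ι (pred n) ℚ.* ι (suc p)) ℚ.* 1/suc p ≡⟨ ℚₚ.*-assoc (ι (pred n)) (ι (suc p)) (1/suc p) ⟩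
    ι (pred n) ℚ.* (ι (suc p) ℚ.* 1/suc p) ≡⟨ cong (ι (pred n) ℚ.*_) (ι-*-1/suc p) ⟩
    ι (pred n) ℚ.* 1ℚ                      ≡⟨ ℚₚ.*-identityʳ (ι (pred n)) ⟩
    ι (pred n)                             ∎)) (ι-mono {pred n} {n} pred[n]≤n))
    where open ≡-Reasoning

  -- ∫ from i to i j is ∫ from 1 to j, subdivided i times as finely.
  module Product (i j : ℕ) where
    q : ℕ
    q = p + i * suc p
    open Refine p i q refl public
    λ-* : λₚ (suc i * suc j) ≡ λₚ (suc i) ℚ.+ riemann q (j * suc p * suc i)
    λ-* = trans (cong (riemann p) (S.solve 3 (λ i j p →
        (j S.:+ i S.:* (S.con 1 S.:+ j)) S.:* p S.:= i S.:* p S.:+ j S.:* p S.:* (S.con 1 S.:+ i)) refl i j (suc p)))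
      (riemann-+ p (i * suc p) (j * suc p * suc i))
      where module S = ℕ-Solver

  -- A right Riemann sum of the decreasing function 1/t only grows under refinement, hence no error
  -- term. In `λ-sub` the growth is at most the mesh 1/(p + 1), which is at most 1 for every p.
  λ-super : ∀ i j → λₚ (suc i) ℚ.+ λₚ (suc j) ℚ.≤ λₚ (suc i * suc j)
  λ-super i j = ℚₚ.≤-trans (ℚₚ.+-monoʳ-≤ (λₚ (suc i)) (lower (j * suc p))) (ℚₚ.≤-reflexive (sym λ-*))
    where open Product i j

  λ-sub : ∀ i j → λₚ (i * j) ℚ.≤ λₚ i ℚ.+ λₚ j ℚ.+ 1ℚ
  λ-sub zero    j       = 0≤x+y (0≤x+y (λ-nonNeg 0) (λ-nonNeg j)) (ι-nonNeg 1)
  λ-sub (suc i) zero    = subst (λ t → λₚ t ℚ.≤ λₚ (suc i) ℚ.+ λₚ 0 ℚ.+ 1ℚ) (sym (*-zeroʳ i))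
    (0≤x+y (0≤x+y (λ-nonNeg (suc i)) (λ-nonNeg 0)) (ι-nonNeg 1))
  λ-sub (suc i) (suc j) = begin
    λₚ (suc i * suc j)                                ≡⟨ λ-* ⟩
    λₚ (suc i) ℚ.+ riemann q (j * suc p * suc i)
      ≤⟨ ℚₚ.+-monoʳ-≤ (λₚ (suc i)) (ℚₚ.≤-trans (upper (j * suc p)) (ℚₚ.+-monoʳ-≤ (λₚ (suc j)) (1/suc≤1 p))) ⟩
    λₚ (suc i) ℚ.+ (λₚ (suc j) ℚ.+ 1ℚ)                ≡⟨ ℚₚ.+-assoc (λₚ (suc i)) (λₚ (suc j)) 1ℚ ⟨
    λₚ (suc i) ℚ.+ λₚ (suc j) ℚ.+ 1ℚ                  ∎
    where
    open ℚₚ.≤-Reasoning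
    open Product i j

  ι-suc-* : ∀ n x → ι (suc n) ℚ.* x ≡ x ℚ.+ ι n ℚ.* x
  ι-suc-* n x = trans (cong (ℚ._* x) (ι-+ 1 n)) (trans (ℚₚ.*-distribʳ-+ x 1ℚ (ι n)) (cong (ℚ._+ ι n ℚ.* x) (ℚₚ.*-identityˡ x)))

  λ-^-lower : ∀ {u} n → 1 ≤ u → ι n ℚ.* λₚ u ℚ.≤ λₚ (u ^ n)
  λ-^-lower {suc u} zero    _   = ℚₚ.≤-trans (ℚₚ.≤-reflexive (ℚₚ.*-zeroˡ (λₚ (suc u)))) (λ-nonNeg 1)
  λ-^-lower {suc u} (suc n) 1≤u = ℚₚ.≤-trans (ℚₚ.≤-reflexive (ι-suc-* n (λₚ (suc u))))
    (ℚₚ.≤-trans (ℚₚ.+-monoʳ-≤ (λₚ (suc u)) (λ-^-lower n 1≤u)) (super (1≤^ n 1≤u)))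
    where
    super : ∀ {v} → 1 ≤ v → λₚ (suc u) ℚ.+ λₚ v ℚ.≤ λₚ (suc u * v)
    super {suc v} _ = λ-super u v

  λ-^-upper : ∀ u n → λₚ (u ^ n) ℚ.≤ ι n ℚ.* (λₚ u ℚ.+ 1ℚ)
  λ-^-upper u zero    = ℚₚ.≤-reflexive (sym (ℚₚ.*-zeroˡ (λₚ u ℚ.+ 1ℚ)))
  λ-^-upper u (suc n) = begin
    λₚ (u * u ^ n)                             ≤⟨ λ-sub u (u ^ n) ⟩
    λₚ u ℚ.+ λₚ (u ^ n) ℚ.+ 1ℚ                 ≤⟨ ℚₚ.+-monoˡ-≤ 1ℚ (ℚₚ.+-monoʳ-≤ (λₚ u) (λ-^-upper u n)) ⟩
    λₚ u ℚ.+ t ℚ.+ 1ℚ                          ≡⟨ solve 3 (λ x t y → x :+ t :+ y := (x :+ y) :+ t) refl (λₚ u) t 1ℚ ⟩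
    (λₚ u ℚ.+ 1ℚ) ℚ.+ t                        ≡⟨ ι-suc-* n (λₚ u ℚ.+ 1ℚ) ⟨
    ι (suc n) ℚ.* (λₚ u ℚ.+ 1ℚ)                ∎
    where
    open ℚₚ.≤-Reasoning
    t = ι n ℚ.* (λₚ u ℚ.+ 1ℚ)

  -- Each use of `λ-sub` costs 1. The errors sum to at most N (Q + 3): N (Q + 1) from `Q ^ N` with
  -- the crude bound Q for its logarithm, s ≤ N from `v ^ s`, and K + 2 ≤ N from K and the two outer
  -- products.
  λ-compare : ∀ {u v r s Q K N} → 1 ≤ u → s ≤ N → K + 2 ≤ N → u ^ r ≤ v ^ s * (Q ^ N * K) →
              ι r ℚ.* λₚ u ℚ.≤ ι s ℚ.* λₚ v ℚ.+ ι N ℚ.* ι (Q + 3)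
  λ-compare {u} {v} {r} {s} {Q} {K} {N} 1≤u s≤N K+2≤N u^r≤ = begin
    ι r ℚ.* λₚ u                                  ≤⟨ λ-^-lower r 1≤u ⟩
    λₚ (u ^ r)                                    ≤⟨ λ-mono u^r≤ ⟩
    λₚ (v ^ s * (Q ^ N * K))                      ≤⟨ λ-sub (v ^ s) (Q ^ N * K) ⟩
    λₚ (v ^ s) ℚ.+ λₚ (Q ^ N * K) ℚ.+ 1ℚ
      ≤⟨ ℚₚ.+-monoˡ-≤ 1ℚ (ℚₚ.+-mono-≤ (λ-^-upper v s) (ℚₚ.≤-trans (λ-sub (Q ^ N) K)
                                                       (ℚₚ.+-monoˡ-≤ 1ℚ (ℚₚ.+-mono-≤ (ℚₚ.≤-trans (λ-^-upper Q N)
                                                         (*-monoʳ (ι-nonNeg N) (ℚₚ.+-monoˡ-≤ 1ℚ (λ≤ι Q)))) (λ≤ι K))))) ⟩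
    S ℚ.* (V ℚ.+ 1ℚ) ℚ.+ (M ℚ.* (q ℚ.+ 1ℚ) ℚ.+ k ℚ.+ 1ℚ) ℚ.+ 1ℚ
      ≡⟨ solve 6 (λ S V M q k o → S :* (V :+ o) :+ (M :* (q :+ o) :+ k :+ o) :+ o
            := (S :* V :+ M :* (q :+ o)) :+ (S :* o :+ (k :+ (o :+ o)))) refl S V M q k 1ℚ ⟩
    (S ℚ.* V ℚ.+ M ℚ.* (q ℚ.+ 1ℚ)) ℚ.+ (S ℚ.* 1ℚ ℚ.+ (k ℚ.+ ι 2))
      ≤⟨ ℚₚ.+-monoʳ-≤ (S ℚ.* V ℚ.+ M ℚ.* (q ℚ.+ 1ℚ)) (ℚₚ.+-mono-≤ (*-monoˡ (ι-nonNeg 1) (ι-mono {s} {N} s≤N))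
            (subst (ℚ._≤ M) (ι-+ K 2) (ι-mono {K + 2} {N} K+2≤N))) ⟩
    (S ℚ.* V ℚ.+ M ℚ.* (q ℚ.+ 1ℚ)) ℚ.+ (M ℚ.* 1ℚ ℚ.+ M)
      ≡⟨ cong (λ t → (S ℚ.* V ℚ.+ M ℚ.* (q ℚ.+ 1ℚ)) ℚ.+ (M ℚ.* 1ℚ ℚ.+ t)) (sym (ℚₚ.*-identityʳ M)) ⟩
    (S ℚ.* V ℚ.+ M ℚ.* (q ℚ.+ 1ℚ)) ℚ.+ (M ℚ.* 1ℚ ℚ.+ M ℚ.* 1ℚ)
      ≡⟨ solve 5 (λ S V M q o → (S :* V :+ M :* (q :+ o)) :+ (M :* o :+ M :* o) := S :* V :+ M :* (q :+ (o :+ o :+ o))) refl S V M q 1ℚ ⟩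
    S ℚ.* V ℚ.+ M ℚ.* (q ℚ.+ ι 3)                 ≡⟨ cong (λ t → S ℚ.* V ℚ.+ M ℚ.* t) (ι-+ Q 3) ⟨
    S ℚ.* V ℚ.+ M ℚ.* ι (Q + 3)                   ∎
    where
    open ℚₚ.≤-Reasoning
    S = ι s
    V = λₚ v
    M = ι N
    q = ι Q
    k = ι K

divide : ∀ i j {x y z} → ι (suc i) ℚ.* x ℚ.≤ ι (suc j) ℚ.* y ℚ.+ z →
         x ℚ.* 1/suc j ℚ.≤ y ℚ.* 1/suc i ℚ.+ z ℚ.* (1/suc j ℚ.* 1/suc i)
divide i j {x} {y} {z} p = begin
  x ℚ.* v                                             ≡⟨ ℚₚ.*-identityˡ (x ℚ.* v) ⟨
  1ℚ ℚ.* (x ℚ.* v)                                    ≡⟨ cong (ℚ._* (x ℚ.* v)) (ι-*-1/suc i) ⟨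
  (s ℚ.* u) ℚ.* (x ℚ.* v)
    ≡⟨ solve 4 (λ s u x v → (s :* u) :* (x :* v) := (s :* x) :* (v :* u)) refl s u x v ⟩
  (s ℚ.* x) ℚ.* (v ℚ.* u)                             ≤⟨ *-monoˡ (*-nonNeg (1/suc-nonNeg j) (1/suc-nonNeg i)) p ⟩
  (t ℚ.* y ℚ.+ z) ℚ.* (v ℚ.* u)
    ≡⟨ solve 5 (λ t y z v u → (t :* y :+ z) :* (v :* u) := (t :* v) :* (y :* u) :+ z :* (v :* u)) refl t y z v u ⟩
  (t ℚ.* v) ℚ.* (y ℚ.* u) ℚ.+ z ℚ.* (v ℚ.* u)
    ≡⟨ cong (λ o → o ℚ.* (y ℚ.* u) ℚ.+ z ℚ.* (v ℚ.* u)) (ι-*-1/suc j) ⟩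
  1ℚ ℚ.* (y ℚ.* u) ℚ.+ z ℚ.* (v ℚ.* u)                ≡⟨ cong (ℚ._+ z ℚ.* (v ℚ.* u)) (ℚₚ.*-identityˡ (y ℚ.* u)) ⟩
  y ℚ.* u ℚ.+ z ℚ.* (v ℚ.* u)                         ∎
  where
  open ℚₚ.≤-Reasoning
  s = ι (suc i)
  t = ι (suc j)
  u = 1/suc i
  v = 1/suc j

≤+⇒∣-∣≤ : ∀ {x y ε} → x ℚ.≤ y ℚ.+ ε → y ℚ.≤ x ℚ.+ ε → ∣ x ℚ.- y ∣ ℚ.≤ ε
≤+⇒∣-∣≤ {x} {y} {ε} p q = ∣x-y∣≤ {x} {y} {ε} (x-y≤e {x} {x} {y} {ε} ℚₚ.≤-refl p) (x-y≤e {y} {y} {x} {ε} ℚₚ.≤-refl q)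

ι-/-≤ : ∀ c i j q → c * suc q ≤ suc i → (ι (suc j) ℚ.* ι c) ℚ.* (1/suc j ℚ.* 1/suc i) ℚ.≤ 1/suc q
ι-/-≤ c i j q p = begin
  (ι (suc j) ℚ.* ι c) ℚ.* (1/suc j ℚ.* 1/suc i)
    ≡⟨ solve 4 (λ t c v u → (t :* c) :* (v :* u) := (t :* v) :* (c :* u)) refl (ι (suc j)) (ι c) (1/suc j) (1/suc i) ⟩
  (ι (suc j) ℚ.* 1/suc j) ℚ.* (ι c ℚ.* 1/suc i)
    ≡⟨ cong₂ ℚ._*_ (trans (ι-*-1/suc j) (sym (ι-*-1/suc q))) refl ⟩
  (ι (suc q) ℚ.* 1/suc q) ℚ.* (ι c ℚ.* 1/suc i)
    ≡⟨ solve 4 (λ s w c u → (s :* w) :* (c :* u) := (c :* s) :* (u :* w)) refl (ι (suc q)) (1/suc q) (ι c) (1/suc i) ⟩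
  (ι c ℚ.* ι (suc q)) ℚ.* (1/suc i ℚ.* 1/suc q)          ≡⟨ cong (ℚ._* (1/suc i ℚ.* 1/suc q)) (ι-* c (suc q)) ⟨
  ι (c * suc q) ℚ.* (1/suc i ℚ.* 1/suc q)
    ≤⟨ *-monoˡ (*-nonNeg (1/suc-nonNeg i) (1/suc-nonNeg q)) (ι-mono {c * suc q} {suc i} p) ⟩
  ι (suc i) ℚ.* (1/suc i ℚ.* 1/suc q)                    ≡⟨ ℚₚ.*-assoc (ι (suc i)) (1/suc i) (1/suc q) ⟨
  (ι (suc i) ℚ.* 1/suc i) ℚ.* 1/suc q                    ≡⟨ cong (ℚ._* 1/suc q) (ι-*-1/suc i) ⟩
  1ℚ ℚ.* 1/suc q                                         ≡⟨ ℚₚ.*-identityˡ (1/suc q) ⟩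
  1/suc q                                                ∎
  where open ℚₚ.≤-Reasoning

-- Limits of sequences of regular reals

triangle : ∀ x y z → ∣ x ℚ.- z ∣ ℚ.≤ ∣ x ℚ.- y ∣ ℚ.+ ∣ y ℚ.- z ∣
triangle x y z = subst (λ t → ∣ t ∣ ℚ.≤ ∣ x ℚ.- y ∣ ℚ.+ ∣ y ℚ.- z ∣)
  (solve 3 (λ x y z → (x :- y) :+ (y :- z) := x :- z) refl x y z) (ℚₚ.∣p+q∣≤∣p∣+∣q∣ (x ℚ.- y) (y ℚ.- z))

∣-∣-sym : ∀ x y → ∣ x ℚ.- y ∣ ≡ ∣ y ℚ.- x ∣
∣-∣-sym x y = trans (sym (ℚₚ.∣-p∣≡∣p∣ (x ℚ.- y))) (cong ∣_∣ (solve 2 (λ x y → :- (x :- y) := y :- x) refl x y))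

-- Halves the tolerance: 1/(2p + 2) is half of 1/(p + 1).
double : ℕ → ℕ
double p = suc (p + p)

1/suc-double : ∀ p → 1/suc (double p) ℚ.+ 1/suc (double p) ≡ 1/suc p
1/suc-double p = trans (cong (ℚ._+ 1/suc (double p)) (sym (ℚₚ.+-identityˡ (1/suc (double p)))))
  (×/-1/suc 1 (double p) p (cong suc (trans (cong suc (cong (λ t → p + t) (sym (+-identityʳ p)))) (sym (+-suc p (p + 0))))))

archimedean : ∀ ε → 0ℚ ℚ.< ε → ∃[ q ] 1/suc q ℚ.+ 1/suc q ℚ.≤ ε
archimedean ε@(mkℚ (+[1+ n ]) d _) _ = double d , ℚₚ.≤-trans (ℚₚ.≤-reflexive (1/suc-double d))
  (ℚₚ.toℚᵘ-cancel-≤ (ℚᵘₚ.≤-respˡ-≃ (ℚᵘₚ.≃-sym (toℚᵘ-/ (+ 1) (suc d)))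
    (ℚᵘ.*≤* (ℤₚ.*-monoʳ-≤-nonNeg (+ suc d) {+ 1} {+ suc n} (ℤ.+≤+ (s≤s z≤n))))))
archimedean (mkℚ (+ 0) d _)    (ℚ.*<* (ℤ.+<+ ()))
archimedean (mkℚ -[1+ n ] d _) (ℚ.*<* ())

module Convergence (x y : ℕ → ℝ) (k₀ N₀ : ℕ → ℕ)
  (close : ∀ q k → k₀ q ≤ k → ∀ N → N₀ k ≤ N → ∀ p → ∣ approx (y N) p ℚ.- approx (x k) p ∣ ℚ.≤ 1/suc q) where

  -- Both terms are compared with a common `y N`, N being beyond both thresholds.
  cauchy : ∀ q q′ k k′ → k₀ q ≤ k → k₀ q′ ≤ k′ → ∀ p → ∣ approx (x k) p ℚ.- approx (x k′) p ∣ ℚ.≤ 1/suc q ℚ.+ 1/suc q′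
  cauchy q q′ k k′ k≥ k′≥ p = ℚₚ.≤-trans (triangle (approx (x k) p) (approx (y N) p) (approx (x k′) p))
    (ℚₚ.+-mono-≤ (ℚₚ.≤-trans (ℚₚ.≤-reflexive (∣-∣-sym (approx (x k) p) (approx (y N) p))) (close q k k≥ N (m≤m⊔n (N₀ k) (N₀ k′)) p))
      (close q′ k′ k′≥ N (m≤n⊔m (N₀ k) (N₀ k′)) p))
    where N = N₀ k ⊔ N₀ k′

  quad : ℕ → ℕ
  quad p = double (double p)

  -- The tolerance 1/(p + 1) is spent in halves: `double p` pays for a change of precision, `quad p`
  -- for a change of index.
  value : ℕ → ℚ
  value p = approx (x (k₀ (quad p))) (double p)

  value-near : ∀ q k p → k₀ q ≤ k → ∣ approx (x k) (double p) ℚ.- value p ∣ ℚ.≤ 1/suc q ℚ.+ 1/suc (quad p)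
  value-near q k p k≥ = cauchy q (quad p) k (k₀ (quad p)) k≥ ≤-refl (double p)

  h : ℝ
  h = record { approx = value ; regular = λ i j → regular-value i j (k₀ (quad i) ⊔ k₀ (quad j)) (m≤m⊔n _ _) (m≤n⊔m _ _) }
    where
    open ℚₚ.≤-Reasoning
    regular-value : ∀ i j k → k₀ (quad i) ≤ k → k₀ (quad j) ≤ k → ∣ value i ℚ.- value j ∣ ℚ.≤ 1/suc i ℚ.+ 1/suc j
    regular-value i j k k≥i k≥j = begin
      ∣ value i ℚ.- value j ∣                                          ≤⟨ triangle (value i) xᵢ (value j) ⟩
      ∣ value i ℚ.- xᵢ ∣ ℚ.+ ∣ xᵢ ℚ.- value j ∣                        ≤⟨ ℚₚ.+-mono-≤
        (ℚₚ.≤-trans (ℚₚ.≤-reflexive (∣-∣-sym (value i) xᵢ)) (ℚₚ.≤-trans (value-near (quad i) k i k≥i) (ℚₚ.≤-reflexive (1/suc-double (double i)))))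
        (ℚₚ.≤-trans (triangle xᵢ xⱼ (value j)) (ℚₚ.+-mono-≤ (regular (x k) (double i) (double j))
          (ℚₚ.≤-trans (value-near (quad j) k j k≥j) (ℚₚ.≤-reflexive (1/suc-double (double j)))))) ⟩
      u ℚ.+ ((u ℚ.+ v) ℚ.+ v)
        ≡⟨ solve 2 (λ u v → u :+ ((u :+ v) :+ v) := (u :+ u) :+ (v :+ v)) refl u v ⟩
      (u ℚ.+ u) ℚ.+ (v ℚ.+ v)
        ≡⟨ cong₂ ℚ._+_ (1/suc-double i) (1/suc-double j) ⟩
      1/suc i ℚ.+ 1/suc j                                              ∎
      where
      xᵢ = approx (x k) (double i)
      xⱼ = approx (x k) (double j)
      u = 1/suc (double i)
      v = 1/suc (double j)

  -- Moving z to precision `double p` costs P + D, and `near` at most ε + D; as D + D = P, this is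
  -- exactly the slack granted by `∣_-_∣≤_`.
  near-h : ∀ (z : ℝ) ε → (∀ p → ∣ approx z (double p) ℚ.- value p ∣ ℚ.≤ ε ℚ.+ 1/suc (quad p)) → ∣ z - h ∣≤ ε
  near-h z ε near p = begin
    ∣ approx z p ℚ.- value p ∣
      ≤⟨ triangle (approx z p) (approx z (double p)) (value p) ⟩
    ∣ approx z p ℚ.- approx z (double p) ∣ ℚ.+ ∣ approx z (double p) ℚ.- value p ∣
      ≤⟨ ℚₚ.+-mono-≤ (regular z p (double p)) (ℚₚ.≤-trans (near p) (ℚₚ.+-monoʳ-≤ ε (1/suc-antimono (≤-trans (m≤m+n (double p) (double p)) (n≤1+n _))))) ⟩
    (P ℚ.+ D) ℚ.+ (ε ℚ.+ D)
      ≡⟨ solve 3 (λ P D ε → (P :+ D) :+ (ε :+ D) := ε :+ (P :+ (D :+ D))) refl P D ε ⟩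
    ε ℚ.+ (P ℚ.+ (D ℚ.+ D))                                      ≡⟨ cong (λ t → ε ℚ.+ (P ℚ.+ t)) (1/suc-double p) ⟩
    ε ℚ.+ (P ℚ.+ P)                                              ∎
    where
    open ℚₚ.≤-Reasoning
    P = 1/suc p
    D = 1/suc (double p)

  x⟶h : x ⟶ h
  x⟶h ε ε>0 with archimedean ε ε>0
  ... | q , 2/q≤ε = k₀ q , λ k k≥ → near-h (x k) ε λ p → ℚₚ.≤-trans (value-near q k p k≥)
    (ℚₚ.+-monoˡ-≤ (1/suc (quad p)) (ℚₚ.≤-trans (x≤x+y (1/suc q) (1/suc-nonNeg q)) 2/q≤ε))

  y⟶h : y ⟶ h
  y⟶h ε ε>0 with archimedean ε ε>0
  -- One 1/(q + 1) leads from y N to the term of x at `k₀ q`, the other from there to the limit.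
  ... | q , 2/q≤ε = N₀ (k₀ q) , λ N N≥ → near-h (y N) ε λ p →
    ℚₚ.≤-trans (triangle (approx (y N) (double p)) (approx (x (k₀ q)) (double p)) (value p))
    (ℚₚ.≤-trans (ℚₚ.+-mono-≤ (close q (k₀ q) ≤-refl N N≥ (double p)) (value-near q (k₀ q) p ≤-refl))
    (ℚₚ.≤-trans (ℚₚ.≤-reflexive (sym (ℚₚ.+-assoc (1/suc q) (1/suc q) (1/suc (quad p)))))
      (ℚₚ.+-monoˡ-≤ (1/suc (quad p)) 2/q≤ε)))

-- The estimates run over n + 1, past the placeholder values at index 0.
⟶-unshift : ∀ {x h} → (λ n → x (suc n)) ⟶ h → x ⟶ h
⟶-unshift x⟶h ε ε>0 with x⟶h ε ε>0
... | n₀ , near = suc n₀ , λ { (suc n) (s≤s n≥) → near n n≥ }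

⟶-subsequence : ∀ {x h} (φ : ℕ → ℕ) → (∀ n → n ≤ φ n) → x ⟶ h → (λ n → x (φ n)) ⟶ h
⟶-subsequence φ n≤φ x⟶h ε ε>0 with x⟶h ε ε>0
... | n₀ , near = n₀ , λ n n≥ → near (φ n) (≤-trans n≥ (n≤φ n))

-- The error N (Q + 3) of `λ-compare`, divided by N L, is (Q + 3) / L; K matters only through the
-- threshold for N.
quotient-close : ∀ {x y L N q Q} K → 1 ≤ x → 1 ≤ y → 0 < L → L ≤ N → K + 2 ≤ N → (Q + 3) * suc q ≤ L →
                 y ^ L ≤ x ^ N * (Q ^ N * K) → x ^ N ≤ y ^ L * (Q ^ N * K) →
                 ∀ p → ∣ approx (ln y ÷ N) p ℚ.- approx (ln x ÷ L) p ∣ ℚ.≤ 1/suc q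
quotient-close {x} {y} {L@(suc i)} {N@(suc j)} {q} {Q} K 1≤x 1≤y _ L≤N K≤N Q≤L y≤ x≤ p = ≤+⇒∣-∣≤
  (ℚₚ.≤-trans (divide i j (λ-compare {y} {x} {L} {N} {Q} {K} {N} 1≤y ≤-refl K≤N y≤))
    (ℚₚ.+-monoʳ-≤ (λₚ x ℚ.* 1/suc i) error))
  (ℚₚ.≤-trans (divide j i (λ-compare {x} {y} {N} {L} {Q} {K} {N} 1≤x L≤N K≤N x≤))
    (ℚₚ.+-monoʳ-≤ (λₚ y ℚ.* 1/suc j) (subst (λ t → (ι N ℚ.* ι (Q + 3)) ℚ.* t ℚ.≤ 1/suc q) (ℚₚ.*-comm (1/suc j) (1/suc i)) error)))
  where
  open Precision p
  error : (ι N ℚ.* ι (Q + 3)) ℚ.* (1/suc j ℚ.* 1/suc i) ℚ.≤ 1/suc q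
  error = ι-/-≤ (Q + 3) i j q Q≤L

-- The common limit

module Entropy (m′ : ℕ) where
  open Inflation m′
  open Tilings m′
  open Growth m′

  log-a log-f : ℕ → ℝ
  log-a k = ln (aₖ k) ÷ l₊ k
  log-f N = ln (f N) ÷ N

  -- `l₊ k` is at least k, so `k₀ q` makes it at least (Q′ + 3)(q + 1). The constant `K k` varies
  -- with the level, so it may enter `N₀` but not `k₀`.
  K k₀ N₀ : ℕ → ℕ
  K k  = proj₁ (Level.comparison k)
  k₀ q = (Q′ + 3) * suc q
  N₀ k = l₊ k ⊔ (K k + 2)

  close : ∀ q k → k₀ q ≤ k → ∀ N → N₀ k ≤ N → ∀ p → ∣ approx (log-f N) p ℚ.- approx (log-a k) p ∣ ℚ.≤ 1/suc q
  close q k k≥ N N≥ = quotient-close {aₖ k} {f N} {l₊ k} {N} {q} {Q′} (K k) (a>0 m k) (f>0 N) (l>0 m k) L≤N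
    (≤-trans (m≤n⊔m (l₊ k) (K k + 2)) N≥) (≤-trans k≥ (n≤l k)) (proj₁ bounds) (proj₂ bounds)
    where
    L≤N : l₊ k ≤ N
    L≤N = ≤-trans (m≤m⊔n (l₊ k) (K k + 2)) N≥
    bounds : f N ^ l₊ k ≤ aₖ k ^ N * (Q′ ^ N * K k) × aₖ k ^ N ≤ f N ^ l₊ k * (Q′ ^ N * K k)
    bounds = proj₂ (Level.comparison k) N L≤N

  open Convergence log-a log-f k₀ N₀ close public

theorem3 :
    (m : ℕ) → 1 ≤ m →
    Σ[ finA ∈ (∀ n → Finite (A m n)) ]
    Σ[ finF ∈ (∀ N → Finite (F (A∞ m) N)) ]
    ∃[ h ]
      ((λ N → ln (card (finF N)) ÷ N) ⟶ h)
      × ((λ n → ln (card (finA n)) ÷ l m n) ⟶ h)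
      × ((λ n → ln (card (finF (l m n))) ÷ l m n) ⟶ h)
theorem3 m@(suc m′) _ = A-finite m , F-finite , h , y⟶h ,
  ⟶-unshift {λ n → ln (card (A-finite m n)) ÷ l m n} {h} x⟶h ,
  ⟶-unshift {λ n → log-f (l m n)} {h} (⟶-subsequence {log-f} {h} (λ n → l m (suc n)) n≤l y⟶h)
  where
  open Inflation m′ using (n≤l)
  open Tilings m′
  open Entropy m′
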